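{- Let $\mathcal X$ be a circulant scheme over a finite cyclic group $G$, let $\mathcal X^\star$ be a singular extension of $\mathcal X$, let $\varphi$ be an algebraic automorphism of $\mathcal X$, and let $m\ge 2$. Assume that $\mathcal X$ is $\mathrm{WL}_m$-equivalent to itself with respect to $\varphi$. Then there exists an algebraic automorphism $\varphi^\star$ of $\mathcal X^\star$ that extends $\varphi$ and such that $\mathcal X^\star$ is $\mathrm{WL}_m$-equivalent to itself with respect to $\varphi^\star$.
   Context: Coherent configurations, circulant schemes: a coherent configuration on $\Omega$ is $(\Omega,S)$ with $S$ a partition of $\Omega\times\Omega$ into basis relations such that $1_\Omega$ is a union of basis relations, $S$ is closed under transposition, and the numbers $c^t_{rs}=|\{\gamma:(\alpha,\gamma)\in r,(\gamma,\beta)\in s\}|$ do not depend on $(\alpha,\beta)\in t$. An algebraic automorphism is a permutation $\varphi$ of $S$ preserving all $c^t_{rs}$. For coherent configurations $\mathcal X\le\mathcal Y$ on the same set (every basis relation of $\mathcal X$ is a union of basis relations of $\mathcal Y$), an algebraic automorphism $\psi$ of $\mathcal Y$ extends $\varphi$ if $\psi(s)=\varphi(s)$ for every basis relation $s$ of $\mathcal X$ (with $\psi$ extended to unions). A circulant scheme over a cyclic group $G$ is a coherent configuration $(G,S)$ with $(\alpha,\beta)\in s\Rightarrow(\alpha g,\beta g)\in s$. For $H\le G$, $e(H)$ is the partition into cosets of $H$; $H$ is an $\mathcal X$-group if $e(H)$ is a union of basis relations. For $\mathcal X$-groups $L\le U$, $U/L$ is a section; $\mathrm{Sec}_1(\mathcal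 X)$ is the set of these; $U(\mathfrak S)=U$, $L(\mathfrak S)=L$; the order of $\mathfrak S$ is $|U/L|$. $\mathcal X_{U/L}$ is the scheme on $U/L$ with basis relations $s_{U/L}=\{(\Gamma,\Gamma'):s\cap(\Gamma\times\Gamma')\ne\varnothing\}$ ($s\in S$ meeting $U\times U$); a section is trivial if its basis relations are only the diagonal and its complement. A scheme is regular if each basis relation $s$ satisfies $|\{\beta:(\alpha,\beta)\in s\}|=1$ for all $\alpha$. $\mathfrak S$ is a multiple of $\mathfrak T$ if $L(\mathfrak T)=U(\mathfrak T)\cap L(\mathfrak S)$ and $U(\mathfrak S)=U(\mathfrak T)L(\mathfrak S)$; projective equivalence is the equivalence relation generated by this. For $\mathcal X$-groups $L\le U$, $\mathcal X$ satisfies the $U/L$-condition if for every basis relation $s$ with $s\cap e(U)=\varnothing$ we have $e(L)\cdot s=s\cdot e(L)=s$ (dot = relational composition). A class $C$ of projectively equivalent sections in $\mathrm{Sec}_1(\mathcal X)$ is singular if it contains a trivial section, its sections have order greater than $2$, and it contains sections $L_1/L_0$ and $U_1/U_0$ with $U_1/U_0$ a multiple of $L_1/L_0$ such that (S1) $\mathcal X$ satisfies the $U_0/L_0$- and $U_1/L_1$-conditions and (S2) $\mathcal X_{U_1/L_0}=\mathcal X_{L_1/L_0}\otimes\mathcal X_{U_0/L_0}$ (tensor product with respect to the internal direct decomposition $U_1/L_0=(L_1/L_0)\times(U_0/L_0)$). For $\mathfrak S\in\mathrm{Sec}_1(\mathcal X)$, the $\mathfrak S$-extension of $\mathcal X$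 is the smallest circulant scheme $\mathcal X^\star\ge\mathcal X$ over $G$ such that $(\mathcal X^\star)_{\mathfrak S}$ is regular; it is a singular extension if $\mathfrak S$ belongs to a singular class. $\mathrm{WL}_m$-equivalence: $\mathrm{WL}_m(\mathcal X)$ is the $m$-ary coherent configuration (partition of $G^m$ into color classes) produced by the $m$-dimensional Weisfeiler–Leman algorithm on $\mathcal X$. An algebraic isomorphism $\hat\varphi$ between $m$-ary coherent configurations is a bijection between classes commuting with the coordinate maps $x\mapsto(x_{1^\sigma},\dots,x_{m^\sigma})$, $\sigma:\{1,\dots,m\}\to\{1,\dots,m\}$, and preserving the numbers $n^{X_0}_{X_1,\dots,X_m}=|\{\alpha: x_{i\leftarrow\alpha}\in X_i\ \forall i\}|$ ($x\in X_0$). $\mathcal X$ is $\mathrm{WL}_m$-equivalent to itself with respect to $\varphi$ if there is an algebraic automorphism $\hat\varphi$ of $\mathrm{WL}_m(\mathcal X)$ whose $2$-projection $\{(x_1,x_2):x\in X\}\mapsto\{(x_1,x_2):x\in\hat\varphi(X)\}$ agrees with $\varphi$ on every basis relation of $\mathcal X$. -}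

module Defs where

open import Data.Nat using (ℕ; zero; suc; _+_; _*_; _∸_; _<_; _≤_)
open import Data.Nat.DivMod using (_%_; _/_; m%n<n)
open import Data.Fin using (Fin; toℕ; fromℕ<; _≟_)
import Data.Fin as Fin
open import Data.List using (List; length; filterᵇ; filter)
open import Data.List.Base using (allFin)
open import Data.Bool using (Bool; true; false; _∧_)
open import Data.Product using (Σ; ∃; ∃-syntax; _×_; _,_)
open import Data.Sum using (_⊎_)
open import Relation.Nullary using (¬_; Dec; yes; no)
open import Relation.Nullary.Decidable using (_×-dec_)
open import Relation.Binary.PropositionalEquality using (_≡_)
open import Function.Bundles using (_↔_; _⇔_; Inverse)

module _ {k : ℕ} where

  private
    N : ℕ
    N = suc k

  _⊕_ : Fin N → Fin N → Fin N
  a ⊕ b = fromℕ< (m%n<n (toℕ a + toℕ b) N)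

  𝟘 : Fin N
  𝟘 = Fin.zero

  ⊖_ : Fin N → Fin N
  ⊖ a = fromℕ< (m%n<n (N ∸ toℕ a) N)

  diff : Fin N → Fin N → Fin N
  diff α β = β ⊕ (⊖ α)

  cardᵇ : (Fin N → Bool) → ℕ
  cardᵇ p = length (filterᵇ p (allFin N))

-- Circulant schemes over G = ℤ/(suc k).  The basis relations are indexed
-- by Fin r; c α β is the basis relation containing (α , β).

module _ {k : ℕ} where

  private
    N : ℕ
    N = suc k

  -- intersection number c^t_{rs} evaluated at a pair (α , β) ∈ t
  isect : ∀ {r} → (Fin N → Fin N → Fin r) → Fin N → Fin N → Fin r → Fin r → ℕ
  isect c α β s₁ s₂ =
    length (filter (λ γ → (c α γ ≟ s₁) ×-dec (c γ β ≟ s₂)) (allFin N))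

  record Scheme : Set where
    field
      r      : ℕ
      c      : Fin N → Fin N → Fin r
      nonempty  : ∀ s → ∃[ α ] ∃[ β ] c α β ≡ s
      -- 1_Ω is a union of basis relations
      diagonal  : ∀ α β γ δ → c α β ≡ c γ δ → (α ≡ β → γ ≡ δ)
      transpose : ∀ α β γ δ → c α β ≡ c γ δ → c β α ≡ c δ γ
      coherent  : ∀ α β γ δ → c α β ≡ c γ δ →
                  ∀ s₁ s₂ → isect c α β s₁ s₂ ≡ isect c γ δ s₁ s₂
      circulant : ∀ α β g → c (α ⊕ g) (β ⊕ g) ≡ c α β
  open Scheme public

  -- X ≤ Y : every basis relation of X is a union of basis relations of Y
  _≤ˢ_ : Scheme → Scheme → Set
  X ≤ˢ Y = ∀ α β γ δ → c Y α β ≡ c Y γ δ → c X α β ≡ c X γ δ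

  record AlgAut (X : Scheme) : Set where
    field
      perm     : Fin (r X) ↔ Fin (r X)
      preserve : ∀ α β α' β' → c X α' β' ≡ Inverse.to perm (c X α β) →
                 ∀ s₁ s₂ → isect (c X) α' β' (Inverse.to perm s₁) (Inverse.to perm s₂)
                           ≡ isect (c X) α β s₁ s₂
  open AlgAut public

  app : ∀ {X} → AlgAut X → Fin (r X) → Fin (r X)
  app φ = Inverse.to (perm φ)

  -- ψ (an algebraic automorphism of Y ≥ X) extends φ:
  -- ψ maps the Y-relations inside a basis relation s of X onto φ(s)
  Extends : (X Y : Scheme) → AlgAut X → AlgAut Y → Set
  Extends X Y φ ψ = ∀ α β γ δ → c Y γ δ ≡ app ψ (c Y α β) → c X γ δ ≡ app φ (c X α β)

  record Subgroup : Set where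
    field
      mem     : Fin N → Bool
      has𝟘    : mem 𝟘 ≡ true
      closed⊕ : ∀ a b → mem a ≡ true → mem b ≡ true → mem (a ⊕ b) ≡ true
      closed⊖ : ∀ a → mem a ≡ true → mem (⊖ a) ≡ true
  open Subgroup public

  _∈ᴴ_ : Fin N → Subgroup → Set
  g ∈ᴴ H = mem H g ≡ true

  _⊆ᴴ_ : Subgroup → Subgroup → Set
  H ⊆ᴴ K = ∀ g → g ∈ᴴ H → g ∈ᴴ K

  _≐ᴴ_ : Subgroup → Subgroup → Set
  H ≐ᴴ K = ∀ g → mem H g ≡ mem K g

  IsMeet : Subgroup → Subgroup → Subgroup → Set
  IsMeet H A B = ∀ g → (g ∈ᴴ H) ⇔ (g ∈ᴴ A × g ∈ᴴ B)

  IsProd : Subgroup → Subgroup → Subgroup → Set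
  IsProd H A B = ∀ g → (g ∈ᴴ H) ⇔ (∃[ a ] ∃[ b ] (a ∈ᴴ A × b ∈ᴴ B × g ≡ a ⊕ b))

  ∣_∣ᴴ : Subgroup → ℕ
  ∣ H ∣ᴴ = cardᵇ (mem H)

  -- X-group: e(H) is a union of basis relations of X
  IsXGroup : Scheme → Subgroup → Set
  IsXGroup X H = ∀ α β γ δ → c X α β ≡ c X γ δ → mem H (diff α β) ≡ mem H (diff γ δ)

  record Section (X : Scheme) : Set where
    constructor _/ˢ_∶_,_,_
    field
      U L  : Subgroup
      L⊆U  : L ⊆ᴴ U
      U-X  : IsXGroup X U
      L-X  : IsXGroup X L
  open Section public

  -- ⌊a/b⌋ (b = 0 never occurs for cardinalities of subgroups)
  divℕ : ℕ → ℕ → ℕ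
  divℕ a zero    = 0
  divℕ a (suc b) = a / suc b

  order : ∀ {X} → Section X → ℕ
  order S = divℕ ∣ U S ∣ᴴ ∣ L S ∣ᴴ

  -- (αL , βL) ∈ s_{U/L}: s meets (αL) × (βL)   (for α, β ∈ U)
  QRel : (X : Scheme) → Subgroup → Fin (r X) → Fin N → Fin N → Set
  QRel X L s α β = ∃[ α₀ ] ∃[ β₀ ] (diff α α₀ ∈ᴴ L × diff β β₀ ∈ᴴ L × c X α₀ β₀ ≡ s)

  -- two pairs of cosets lie in the same basis relation of X_{U/L}
  QSame : (X : Scheme) → Subgroup → Fin N → Fin N → Fin N → Fin N → Set
  QSame X L α β α' β' = ∃[ s ] (QRel X L s α β × QRel X L s α' β')

  -- X_{U/L} is trivial: every basis relation s_{U/L} (s meeting U × U)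
  -- is the diagonal or its complement in U/L × U/L
  Trivial : (X : Scheme) → Section X → Set
  Trivial X S = ∀ s → (∃[ α ] ∃[ β ] (α ∈ᴴ U S × β ∈ᴴ U S × c X α β ≡ s)) →
      (∀ α β → α ∈ᴴ U S → β ∈ᴴ U S → QRel X (L S) s α β ⇔ (diff α β ∈ᴴ L S))
    ⊎ (∀ α β → α ∈ᴴ U S → β ∈ᴴ U S → QRel X (L S) s α β ⇔ (¬ (diff α β ∈ᴴ L S)))

  RegularOn : (X : Scheme) → Subgroup → Subgroup → Set
  RegularOn X U L = ∀ s → (∃[ α ] ∃[ β ] (α ∈ᴴ U × β ∈ᴴ U × c X α β ≡ s)) →
    ∀ α → α ∈ᴴ U →
        (∃[ β ] (β ∈ᴴ U × QRel X L s α β))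
      × (∀ β β' → β ∈ᴴ U → β' ∈ᴴ U → QRel X L s α β → QRel X L s α β' → diff β β' ∈ᴴ L)

  MultipleOf : ∀ {X} → Section X → Section X → Set
  MultipleOf S T = IsMeet (L T) (U T) (L S) × IsProd (U S) (U T) (L S)

  data ProjEq {X : Scheme} : Section X → Section X → Set where
    pe-refl  : ∀ {S} → ProjEq S S
    pe-mult  : ∀ {S T} → MultipleOf S T → ProjEq S T
    pe-sym   : ∀ {S T} → ProjEq S T → ProjEq T S
    pe-trans : ∀ {S T R} → ProjEq S T → ProjEq T R → ProjEq S R

  -- the U/L-condition (for subgroups L ⊆ U):
  -- every basis relation s with s ∩ e(U) = ∅ satisfies e(L)·s = s·e(L) = s
  Condition : (X : Scheme) → Subgroup → Subgroup → Set
  Condition X U L = ∀ s → (∀ α β → c X α β ≡ s → ¬ (diff α β ∈ᴴ U)) →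
      (∀ α β → (∃[ γ ] (diff α γ ∈ᴴ L × c X γ β ≡ s)) ⇔ (c X α β ≡ s))
    × (∀ α β → (∃[ γ ] (c X α γ ≡ s × diff γ β ∈ᴴ L)) ⇔ (c X α β ≡ s))

  -- (S2): X_{U₁/L₀} = X_{L₁/L₀} ⊗ X_{U₀/L₀} w.r.t. U₁/L₀ = (L₁/L₀) × (U₀/L₀):
  -- two pairs of cosets lie in the same basis relation of X_{U₁/L₀} iff their
  -- L₁/L₀- and U₀/L₀-components do so in X_{L₁/L₀} and X_{U₀/L₀} respectively
  TensorCond : (X : Scheme) → (U₁ L₁ U₀ L₀ : Subgroup) → Set
  TensorCond X U₁ L₁ U₀ L₀ =
    ∀ a₁ a₂ b₁ b₂ a₁' a₂' b₁' b₂' →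
      a₁ ∈ᴴ L₁ → b₁ ∈ᴴ L₁ → a₁' ∈ᴴ L₁ → b₁' ∈ᴴ L₁ →
      a₂ ∈ᴴ U₀ → b₂ ∈ᴴ U₀ → a₂' ∈ᴴ U₀ → b₂' ∈ᴴ U₀ →
      QSame X L₀ (a₁ ⊕ a₂) (b₁ ⊕ b₂) (a₁' ⊕ a₂') (b₁' ⊕ b₂')
        ⇔ (QSame X L₀ a₁ b₁ a₁' b₁' × QSame X L₀ a₂ b₂ a₂' b₂')

  SingularClassOf : (X : Scheme) → Section X → Set
  SingularClassOf X S =
      (∃[ T ] (ProjEq S T × Trivial X T))
    × (∀ T → ProjEq S T → 2 < order T)
    × ∃[ T₁ ] ∃[ T₂ ]   -- T₁ = L₁/L₀ , T₂ = U₁/U₀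
        ( ProjEq S T₁ × ProjEq S T₂ × MultipleOf T₂ T₁
        × (Condition X (L T₂) (L T₁) × Condition X (U T₂) (U T₁))
        × TensorCond X (U T₂) (U T₁) (L T₂) (L T₁))

  IsExtension : (X : Scheme) → Section X → Scheme → Set
  IsExtension X S Xs =
      X ≤ˢ Xs
    × RegularOn Xs (U S) (L S)
    × (∀ Z → X ≤ˢ Z → RegularOn Z (U S) (L S) → Xs ≤ˢ Z)

  Tup : ℕ → Set
  Tup m = Fin m → Fin N

  upd : ∀ {m} → Tup m → Fin m → Fin N → Tup m
  upd x i α j with i ≟ j
  ... | yes _ = α
  ... | no  _ = x j

  -- colour equivalence after the j-th refinement round of WL_m on X
  WLeq : ∀ {m} → Scheme → ℕ → Tup m → Tup m → Set
  WLeq X zero    x y = ∀ i j → c X (x i) (x j) ≡ c X (y i) (y j)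
  WLeq X (suc t) x y = WLeq X t x y
    × Σ (Fin N ↔ Fin N) λ π → ∀ α i → WLeq X t (upd x i α) (upd y i (Inverse.to π α))

  -- same class of WL_m(X) (stable colouring)
  _≈[_]_ : ∀ {m} → Tup m → Scheme → Tup m → Set
  x ≈[ X ] y = ∀ t → WLeq X t x y

  -- X is WL_m-equivalent to itself w.r.t. φ (m = suc (suc m')):
  -- an algebraic automorphism φ̂ of WL_m(X), encoded by the relation
  -- "φ̂ maps the class of x to the class of y", whose 2-projection agrees with φ
  record WLSelfEquiv (X : Scheme) (m' : ℕ) (φ : AlgAut X) : Set₁ where
    private
      m = suc (suc m')
    field
      R     : Tup m → Tup m → Set
      resp  : ∀ x x' y y' → x ≈[ X ] x' → y ≈[ X ] y' → R x y → R x' y'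
      total : ∀ x → ∃[ y ] R x y
      onto  : ∀ y → ∃[ x ] R x y
      func  : ∀ x y y' → R x y → R x y' → y ≈[ X ] y'
      inj   : ∀ x x' y → R x y → R x' y → x ≈[ X ] x'
      coord : ∀ (σ : Fin m → Fin m) x y → R x y → R (λ i → x (σ i)) (λ i → y (σ i))
      -- preserves the numbers n^{X₀}_{X₁…X_m}: the sets
      -- {α : x_{i←α} ∈ X_i ∀i} and {α : y_{i←α} ∈ φ̂(X_i) ∀i} are equinumerous
      numbers : ∀ x y → R x y → ∀ (z w : Fin m → Tup m) → (∀ i → R (z i) (w i)) →
                Σ (Fin N ↔ Fin N) λ π → ∀ α →
                  (∀ i → upd x i α ≈[ X ] z i) ⇔ (∀ i → upd y i (Inverse.to π α) ≈[ X ] w i)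
      proj₂-agrees : ∀ x y → R x y →
        c X (y Fin.zero) (y (Fin.suc Fin.zero)) ≡ app φ (c X (x Fin.zero) (x (Fin.suc Fin.zero)))

{-# OPTIONS --safe #-}

-- Write L₁/L₀ and U₁/U₀ for the two sections of the singular class.  Since L₁/L₀ is trivial, (S1)
-- and (S2) imply that exchanging two U₀-cosets inside a U₁-coset by translations from L₁ is
-- an automorphism of X.  The extension X* arises from X by splitting every basis relation inside
-- e(U₁) according to the U₀-coset of the differences.  A tuple relation defining a WL-equivalence of
-- X is restricted to those pairs (x , y) for which differences xⱼ - xᵢ in U₁ agree with yⱼ - yᵢ
-- modulo U₀.  The restriction still admits the required bijections: for a pebble placed in a
-- U₁-coset met by x but in a U₀-coset not met by x, the exchanges distribute the candidates of each
-- type evenly among the unoccupied U₀-cosets, so that the numbers of candidates agree coset by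
-- coset.  Applied to pairs this gives the coherence of the split scheme, applied to the classes of
-- WL(X) it describes the classes of WL(X*), and applied to φ̂ it gives the extension of φ̂.

module Submission where

open import Defs
open import Data.Nat using (ℕ; zero; suc; _+_; _*_; _∸_; _^_; _≤_; _<_; z≤n; s≤s; s≤s⁻¹; NonZero; >-nonZero)
import Data.Nat.Properties as ℕ
open import Data.Nat.DivMod using (_%_; _/_; m%n<n; m<n⇒m%n≡m; %-distribˡ-+; n%n≡0; m≡m%n+[m/n]*n)
open import Data.Nat.Divisibility using (_∣_; divides; m%n≡0⇒n∣m; n∣m*n)
open import Data.Fin using (Fin; zero; suc; _≟_; toℕ; fromℕ<; cast; punchOut; remQuot; combine; finToFun; funToFin)
import Data.Fin.Properties as Fin
open import Data.Fin.Properties using (any?; all?)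
open import Data.Bool using (Bool; true; if_then_else_)
import Data.Bool.Properties as Bool
open import Data.Empty using (⊥-elim)
open import Data.List using (List; []; _∷_; length; filter; lookup; tabulate; allFin)
open import Data.List.Properties using (filter-≐)
open import Data.List.Membership.Propositional using (_∈_)
open import Data.List.Membership.Propositional.Properties using (∈-filter⁺; ∈-filter⁻; ∈-allFin; ∈-lookup)
open import Data.List.Relation.Unary.Any using (here; there; index)
open import Data.List.Relation.Unary.Any.Properties using (lookup-index)
import Data.List.Relation.Unary.All as All
open import Data.List.Relation.Unary.AllPairs using (_∷_)
open import Data.List.Relation.Unary.Unique.Propositional using (Unique)
open import Data.List.Relation.Unary.Unique.Propositional.Properties using (filter⁺; allFin⁺)
open import Data.Product using (Σ; ∃; ∃-syntax; _×_; _,_; proj₁; proj₂)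
open import Data.Sum using (_⊎_; inj₁; inj₂)
open import Data.Vec using (Vec; []; _∷_; zipWith; replicate)
import Data.Vec as Vec
open import Function using (_∘_; id)
open import Function.Bundles using (_↔_; _⇔_; Inverse; mk↔ₛ′; mk⇔; Equivalence)
open import Function.Construct.Identity using (↔-id; ⇔-id)
open import Function.Construct.Symmetry using (↔-sym; ⇔-sym)
open import Function.Construct.Composition using (_↔-∘_; _⇔-∘_)
open import Relation.Nullary using (¬_; Dec; yes; no; does)
open import Relation.Nullary.Decidable using (¬?; _×-dec_; _→-dec_; map′; dec-true; dec-false)
open import Relation.Unary using (Decidable)
open import Relation.Binary.PropositionalEquality using (_≡_; _≢_; _≗_; refl; sym; trans; cong; cong₂; subst; subst₂; module ≡-Reasoning)
open import Algebra.Properties.Semiring.Sum ℕ.+-*-semiring using (sum; sum-cong-≗; ∑-comm; sum-permute; *-distribˡ-sum; *-distribʳ-sum)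

-- Counting in finite sets

-- Compatibility rests on `U₀` and `U₁`, but φ̂ is not given as respecting these groups. It carries
-- e(H), for an X-group H, to the relation of an X-group with as many elements, and in a cyclic
-- group the order determines the subgroup; so tuples related by φ̂ show the same coincidences of
-- cosets. An image of a tuple under φ̂ may fail to be compatible with it, so totality of the
-- restricted relation has to be proved anew: it holds between constant tuples, and moves preserve
-- it. Bijections for the game are obtained by counting. This needs decidable relations, hence a
-- round at which the refinement is stable. The trivial section of the class and the section at
-- which X* is regular may differ from the two sections that carry (S1) and (S2). Triviality and
-- regularity are therefore restated as conditions on colours that pass along projective
-- equivalence. Finally X* is given only by minimality; it is identified with the split scheme by
-- two inclusions.

injective→surjective : ∀ {n} (f : Fin n → Fin n) → (∀ {i j} → f i ≡ f j → i ≡ j) → ∀ j → ∃[ i ] f i ≡ j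
injective→surjective {suc n} f inj j with any? (λ i → f i ≟ j)
... | yes h = h
... | no ∄ = ⊥-elim (Fin.<⇒notInjective {f = λ i → punchOut (j≢f i)} ℕ.≤-refl
    (λ {i} {i′} e → inj (Fin.punchOut-injective (j≢f i) (j≢f i′) e)))
  where
  j≢f : ∀ i → j ≢ f i
  j≢f i e = ∄ (i , sym e)

injective→bijection : ∀ {n} (f : Fin n → Fin n) → (∀ {i j} → f i ≡ f j → i ≡ j) →
  Σ (Fin n ↔ Fin n) (λ π → ∀ i → Inverse.to π i ≡ f i)
injective→bijection {n} f inj = mk↔ₛ′ f g f∘g (λ i → inj (f∘g (f i))) , λ _ → refl
  where
  g : Fin n → Fin n
  g j = proj₁ (injective→surjective f inj j)
  f∘g : ∀ j → f (g j) ≡ j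
  f∘g j = proj₂ (injective→surjective f inj j)

-- Counting by sums of indicators.

ind : ∀ {P : Set} → Dec P → ℕ
ind d = if does d then 1 else 0

ind-yes : ∀ {P : Set} (d : Dec P) → P → ind d ≡ 1
ind-yes d p = cong (if_then 1 else 0) (dec-true d p)

ind-no : ∀ {P : Set} (d : Dec P) → ¬ P → ind d ≡ 0
ind-no d p = cong (if_then 1 else 0) (dec-false d p)

ind-⇔ : ∀ {P Q : Set} (d : Dec P) (e : Dec Q) → (P → Q) → (Q → P) → ind d ≡ ind e
ind-⇔ (yes p) e f g = sym (ind-yes e (f p))
ind-⇔ (no ¬p) e f g = sym (ind-no e (¬p ∘ g))

ind-mono : ∀ {P Q : Set} (d : Dec P) (e : Dec Q) → (P → Q) → ind d ≤ ind e
ind-mono (yes p) e f = ℕ.≤-reflexive (sym (ind-yes e (f p)))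
ind-mono (no _) e f = z≤n

# : ∀ {n} {P : Fin n → Set} → Decidable P → ℕ
# P? = sum (λ i → ind (P? i))

module _ {n : ℕ} where

  #-cong : {P Q : Fin n → Set} (P? : Decidable P) (Q? : Decidable Q) → (∀ i → P i → Q i) → (∀ i → Q i → P i) → # P? ≡ # Q?
  #-cong P? Q? f g = sum-cong-≗ (λ i → ind-⇔ (P? i) (Q? i) (f i) (g i))

  #-bijection : {P Q : Fin n → Set} (P? : Decidable P) (Q? : Decidable Q) (π : Fin n ↔ Fin n) →
    (∀ i → P i → Q (Inverse.to π i)) → (∀ i → Q (Inverse.to π i) → P i) → # P? ≡ # Q?
  #-bijection P? Q? π f g = trans (sum-cong-≗ (λ i → ind-⇔ (P? i) (Q? (Inverse.to π i)) (f i) (g i)))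
    (sym (sum-permute (λ i → ind (Q? i)) π))

#-positive : ∀ {n} {P : Fin n → Set} (P? : Decidable P) i → P i → 0 < # P?
#-positive P? zero p = ℕ.≤-trans (ℕ.≤-reflexive (sym (ind-yes (P? zero) p))) (ℕ.m≤m+n _ _)
#-positive P? (suc i) p = ℕ.≤-trans (#-positive (P? ∘ suc) i p) (ℕ.m≤n+m _ _)

#-witness : ∀ {n} {P : Fin n → Set} (P? : Decidable P) → 0 < # P? → ∃ P
#-witness {suc n} P? lt with P? zero
... | yes p = zero , p
... | no ¬p = let i , q = #-witness (P? ∘ suc) lt in suc i , q

#-mono : ∀ {n} {P Q : Fin n → Set} (P? : Decidable P) (Q? : Decidable Q) → (∀ i → P i → Q i) → # P? ≤ # Q?
#-mono {zero} P? Q? f = z≤n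
#-mono {suc n} P? Q? f = ℕ.+-mono-≤ (ind-mono (P? zero) (Q? zero) (f zero)) (#-mono (P? ∘ suc) (Q? ∘ suc) (f ∘ suc))

#-strict : ∀ {n} {P Q : Fin n → Set} (P? : Decidable P) (Q? : Decidable Q) → (∀ i → P i → Q i) →
  ∀ i → Q i → ¬ P i → # P? < # Q?
#-strict P? Q? f zero q ¬p = ℕ.+-mono-≤ (ℕ.≤-reflexive (trans (cong suc (ind-no (P? zero) ¬p)) (sym (ind-yes (Q? zero) q))))
  (#-mono (P? ∘ suc) (Q? ∘ suc) (f ∘ suc))
#-strict {suc n} P? Q? f (suc i) q ¬p = ℕ.≤-trans (ℕ.≤-reflexive (sym (ℕ.+-suc _ _)))
  (ℕ.+-mono-≤ (ind-mono (P? zero) (Q? zero) (f zero)) (#-strict (P? ∘ suc) (Q? ∘ suc) (f ∘ suc) i q ¬p))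

length-filter-tabulate : ∀ {A : Set} {n} (f : Fin n → A) {P : A → Set} (P? : Decidable P) →
  length (filter P? (tabulate f)) ≡ # (P? ∘ f)
length-filter-tabulate {n = zero} f P? = refl
length-filter-tabulate {n = suc n} f P? with P? (f zero)
... | yes _ = cong suc (length-filter-tabulate (f ∘ suc) P?)
... | no _ = length-filter-tabulate (f ∘ suc) P?

length-filter : ∀ {n} {P : Fin n → Set} (P? : Decidable P) → length (filter P? (allFin n)) ≡ # P?
length-filter P? = length-filter-tabulate id P?

lookup-injective : ∀ {A : Set} {xs : List A} → Unique xs → ∀ i j → lookup xs i ≡ lookup xs j → i ≡ j
lookup-injective {xs = x ∷ xs} (_ ∷ u) zero zero e = refl
lookup-injective {xs = x ∷ xs} (a ∷ u) zero (suc j) e = ⊥-elim (All.lookup a (∈-lookup j) e)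
lookup-injective {xs = x ∷ xs} (a ∷ u) (suc i) zero e = ⊥-elim (All.lookup a (∈-lookup i) (sym e))
lookup-injective {xs = x ∷ xs} (_ ∷ u) (suc i) (suc j) e = cong suc (lookup-injective u i j e)

-- A difunctional relation is a disjoint union of complete bipartite graphs.
Difunctional : {A B : Set} → (A → B → Set) → Set
Difunctional P = ∀ {a b a′ b′} → P a b → P a′ b → P a′ b′ → P a b′

-- On each block a bijection exists exactly when its two sides have equal size. This turns the
-- search for Duplicator's bijections into counting and makes their existence decidable.
module Matching {n : ℕ} {P : Fin n → Fin n → Set} (P? : ∀ a b → Dec (P a b)) (difun : Difunctional P) where

  Balanced : Set
  Balanced = (∀ a → ∃[ b ] P a b) × (∀ a b → P a b → # (P? a) ≡ # (λ a′ → P? a′ b))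

  perfect : Set
  perfect = Σ (Fin n ↔ Fin n) (λ π → ∀ a → P a (Inverse.to π a))

  perfect→balanced : perfect → Balanced
  perfect→balanced (π , h) = (λ a → Inverse.to π a , h a) ,
    λ a b p → sym (#-bijection (λ a′ → P? a′ b) (P? a) π (λ a′ q → difun p q (h a′)) (λ a′ q → difun (h a′) q p))

  private
    -- The lists belonging to two points are equal only propositionally. Stating the claim for
    -- arbitrary lists allows these equalities to be matched with `refl`.
    same-index : ∀ {xs ys rs rs′ : List (Fin n)} → xs ≡ ys → rs ≡ rs′ → (p : length xs ≡ length rs) (p′ : length ys ≡ length rs′) →
      ∀ {a a′} (i : a ∈ xs) (i′ : a′ ∈ ys) → Unique rs →
      lookup rs (cast p (index i)) ≡ lookup rs′ (cast p′ (index i′)) → a ≡ a′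
    same-index {xs} refl refl p p′ i i′ u e = trans (lookup-index i) (trans (cong (lookup xs) i≡i′) (sym (lookup-index i′)))
      where
      i≡i′ : index i ≡ index i′
      i≡i′ = Fin.toℕ-injective (trans (sym (Fin.toℕ-cast p _)) (trans (cong toℕ (lookup-injective u _ _ e)) (Fin.toℕ-cast p′ _)))

  -- The i-th element of a column is sent to the i-th element of the row.
  balanced→perfect : Balanced → perfect
  balanced→perfect (tot , bal) = let π , h = injective→bijection f f-inj in π , λ a → subst (P a) (sym (h a)) (P-f a)
    where
    b₀ : Fin n → Fin n
    b₀ a = proj₁ (tot a)
    row col : Fin n → List (Fin n)
    row a = filter (P? a) (allFin n)
    col a = filter (λ a′ → P? a′ (b₀ a)) (allFin n)
    a∈col : ∀ a → a ∈ col a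
    a∈col a = ∈-filter⁺ _ (∈-allFin a) (proj₂ (tot a))
    len : ∀ a → length (col a) ≡ length (row a)
    len a = trans (length-filter (λ a′ → P? a′ (b₀ a))) (trans (sym (bal a (b₀ a) (proj₂ (tot a)))) (sym (length-filter (P? a))))
    f : Fin n → Fin n
    f a = lookup (row a) (cast (len a) (index (a∈col a)))
    P-f : ∀ a → P a (f a)
    P-f a = proj₂ (∈-filter⁻ (P? a) {xs = allFin n} (∈-lookup {xs = row a} (cast (len a) (index (a∈col a)))))
    f-inj : ∀ {a a′} → f a ≡ f a′ → a ≡ a′
    -- A common image puts `a` and `a′` into one block, where their rows and columns coincide as
    -- lists; equal entries then have equal positions.
    f-inj {a} {a′} e = same-index
      (filter-≐ _ _ ((λ q → difun q (proj₂ (tot a)) (difun p p′ (proj₂ (tot a′)))) ,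
                     (λ q → difun q (proj₂ (tot a′)) (difun p′ p (proj₂ (tot a))))) (allFin n))
      (filter-≐ _ _ ((λ q → difun p′ p q) , (λ q → difun p p′ q)) (allFin n))
      (len a) (len a′) (a∈col a) (a∈col a′) (filter⁺ (P? a) (allFin⁺ n)) e
      where
      p : P a (f a)
      p = P-f a
      p′ : P a′ (f a)
      p′ = subst (P a′) (sym e) (P-f a′)

  balanced? : Dec Balanced
  balanced? = all? (λ a → any? (P? a)) ×-dec all? (λ a → all? (λ b → P? a b →-dec (_ ℕ.≟ _)))

  perfect? : Dec perfect
  perfect? = map′ balanced→perfect perfect→balanced balanced?

-- Both sides count the pairs `(w , a)` with `W w`, `A a` and `E w a`, grouped by `w` on the left
-- and by `a` on the right.
double-count : ∀ {n} {A W : Fin n → Set} {E : Fin n → Fin n → Set}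
  (A? : Decidable A) (W? : Decidable W) (E? : ∀ a b → Dec (E a b)) (k e : ℕ) →
  (∀ w → W w → # (λ a → A? a ×-dec E? w a) ≡ k) →
  (∀ a → A a → # (λ w → W? w ×-dec E? w a) ≡ e) →
  # W? * k ≡ # A? * e
double-count {n} {A} {W} {E} A? W? E? k e hk he = begin
  # W? * k ≡⟨ *-distribʳ-sum k (λ w → ind (W? w)) ⟩
  sum (λ w → ind (W? w) * k) ≡⟨ sum-cong-≗ wk ⟩
  sum (λ w → sum (λ a → F w a)) ≡⟨ ∑-comm F ⟩
  sum (λ a → sum (λ w → F w a)) ≡⟨ sum-cong-≗ ae ⟨
  sum (λ a → ind (A? a) * e) ≡⟨ *-distribʳ-sum e (λ a → ind (A? a)) ⟨
  # A? * e ∎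
  where
  open ≡-Reasoning
  F : Fin n → Fin n → ℕ
  F w a = ind (W? w ×-dec (A? a ×-dec E? w a))
  wk : ∀ w → ind (W? w) * k ≡ sum (F w)
  wk w with W? w
  ... | yes p = trans (ℕ.*-identityˡ k) (trans (sym (hk w p)) (sum-cong-≗ (λ a → ind-⇔ (A? a ×-dec E? w a) (yes p ×-dec (A? a ×-dec E? w a)) (p ,_) proj₂)))
  -- The summands are written `0 * 0` so that distributivity pulls out a factor 0 and evaluates the
  -- sum.
  ... | no ¬p = sym (trans (sum-cong-≗ {_} {λ a → ind (no ¬p ×-dec (A? a ×-dec E? w a))} {λ _ → 0 * 0} (λ a → ind-no (no ¬p ×-dec (A? a ×-dec E? w a)) (¬p ∘ proj₁))) (sym (*-distribˡ-sum {n} 0 (λ _ → 0))))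
  ae : ∀ a → ind (A? a) * e ≡ sum (λ w → F w a)
  ae a with A? a
  ... | yes p = trans (ℕ.*-identityˡ e) (trans (sym (he a p)) (sum-cong-≗ (λ w → ind-⇔ (W? w ×-dec E? w a) (W? w ×-dec (yes p ×-dec E? w a)) (λ (x , y) → x , p , y) (λ (x , _ , y) → x , y))))
  ... | no ¬p = sym (trans (sum-cong-≗ {_} {λ w → ind (W? w ×-dec (no ¬p ×-dec E? w a))} {λ _ → 0 * 0} (λ w → ind-no (W? w ×-dec (no ¬p ×-dec E? w a)) (¬p ∘ proj₁ ∘ proj₂))) (sym (*-distribˡ-sum {n} 0 (λ _ → 0))))

-- The point `zero` either joins the class of a related point of the tail or opens a new class. A
-- `Scheme` numbers its colours by some `Fin r` without gaps; the split scheme gets its colours from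
-- here.
quotient : ∀ n {E : Fin n → Fin n → Set} → (∀ a b → Dec (E a b)) → (∀ {a} → E a a) → (∀ {a b} → E a b → E b a) →
  (∀ {a b c} → E a b → E b c → E a c) →
  ∃[ r ] Σ (Fin n → Fin r) λ f → (∀ s → ∃[ a ] f a ≡ s) × (∀ a b → f a ≡ f b → E a b) × (∀ a b → E a b → f a ≡ f b)
quotient zero E? rfl sy tr = 0 , (λ ()) , (λ ()) , (λ ()) , (λ ())
quotient (suc n) {E} E? rfl sy tr with quotient n {λ a b → E (suc a) (suc b)} (λ a b → E? (suc a) (suc b)) rfl sy tr | any? (λ a → E? zero (suc a))
... | r , f , onto , eff , cmp | yes (a₀ , e₀) = r , g , (λ s → suc (proj₁ (onto s)) , proj₂ (onto s)) , eff′ , cmp′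
  where
  g : Fin (suc n) → Fin r
  g zero = f a₀
  g (suc a) = f a
  eff′ : ∀ a b → g a ≡ g b → E a b
  eff′ zero zero e = rfl
  eff′ zero (suc b) e = tr e₀ (eff a₀ b e)
  eff′ (suc a) zero e = tr (eff a a₀ e) (sy e₀)
  eff′ (suc a) (suc b) e = eff a b e
  cmp′ : ∀ a b → E a b → g a ≡ g b
  cmp′ zero zero e = refl
  cmp′ zero (suc b) e = cmp a₀ b (tr (sy e₀) e)
  cmp′ (suc a) zero e = cmp a a₀ (tr e e₀)
  cmp′ (suc a) (suc b) e = cmp a b e
... | r , f , onto , eff , cmp | no ∄ = suc r , g , onto′ , eff′ , cmp′
  where
  g : Fin (suc n) → Fin (suc r)
  g zero = zero
  g (suc a) = suc (f a)
  onto′ : ∀ s → ∃[ a ] g a ≡ s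
  onto′ zero = zero , refl
  onto′ (suc s) = let a , e = onto s in suc a , cong suc e
  eff′ : ∀ a b → g a ≡ g b → E a b
  eff′ zero zero e = rfl
  eff′ (suc a) (suc b) e = eff a b (Fin.suc-injective e)
  cmp′ : ∀ a b → E a b → g a ≡ g b
  cmp′ zero zero e = refl
  cmp′ zero (suc b) e = ⊥-elim (∄ (b , e))
  cmp′ (suc a) zero e = ⊥-elim (∄ (a , sy e))
  cmp′ (suc a) (suc b) e = cong suc (cmp a b e)

-- The cyclic group

module _ {k : ℕ} where

  private
    N : ℕ
    N = suc k

  resid : ℕ → Fin N
  resid n = fromℕ< (m%n<n n N)

  toℕ-resid : ∀ n → toℕ (resid n) ≡ n % N
  toℕ-resid n = Fin.toℕ-fromℕ< (m%n<n n N)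

  resid-cong : ∀ {m n} → m % N ≡ n % N → resid m ≡ resid n
  resid-cong {m} {n} e = Fin.toℕ-injective (trans (toℕ-resid m) (trans e (sym (toℕ-resid n))))

  resid-toℕ : ∀ a → resid (toℕ a) ≡ a
  resid-toℕ a = Fin.toℕ-injective (trans (toℕ-resid (toℕ a)) (m<n⇒m%n≡m (Fin.toℕ<n a)))

  resid-+ : ∀ m n → resid (m + n) ≡ resid m ⊕ resid n
  resid-+ m n = resid-cong {m + n} {toℕ (resid m) + toℕ (resid n)} (trans (%-distribˡ-+ m n N)
    (cong₂ (λ x y → (x + y) % N) (sym (toℕ-resid m)) (sym (toℕ-resid n))))

  resid-N : resid N ≡ 𝟘
  resid-N = resid-cong {N} {0} (n%n≡0 N)

  ⊕-comm : ∀ a b → a ⊕ b ≡ b ⊕ a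
  ⊕-comm a b = cong resid (ℕ.+-comm (toℕ a) (toℕ b))

  ⊕-assoc : ∀ a b c → (a ⊕ b) ⊕ c ≡ a ⊕ (b ⊕ c)
  ⊕-assoc a b c = begin
    resid (toℕ a + toℕ b) ⊕ c               ≡⟨ cong (resid (toℕ a + toℕ b) ⊕_) (resid-toℕ c) ⟨
    resid (toℕ a + toℕ b) ⊕ resid (toℕ c)   ≡⟨ resid-+ (toℕ a + toℕ b) (toℕ c) ⟨
    resid (toℕ a + toℕ b + toℕ c)           ≡⟨ cong resid (ℕ.+-assoc (toℕ a) (toℕ b) (toℕ c)) ⟩
    resid (toℕ a + (toℕ b + toℕ c))         ≡⟨ resid-+ (toℕ a) (toℕ b + toℕ c) ⟩
    resid (toℕ a) ⊕ resid (toℕ b + toℕ c)   ≡⟨ cong (_⊕ resid (toℕ b + toℕ c)) (resid-toℕ a) ⟩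
    a ⊕ (b ⊕ c) ∎
    where open ≡-Reasoning

  ⊕-identityˡ : ∀ a → 𝟘 ⊕ a ≡ a
  ⊕-identityˡ = resid-toℕ

  ⊕-identityʳ : ∀ a → a ⊕ 𝟘 ≡ a
  ⊕-identityʳ a = trans (⊕-comm a 𝟘) (⊕-identityˡ a)

  ⊕-inverseʳ : ∀ a → a ⊕ (⊖ a) ≡ 𝟘
  ⊕-inverseʳ a = begin
    a ⊕ resid (N ∸ toℕ a)               ≡⟨ cong (_⊕ resid (N ∸ toℕ a)) (resid-toℕ a) ⟨
    resid (toℕ a) ⊕ resid (N ∸ toℕ a)   ≡⟨ resid-+ (toℕ a) (N ∸ toℕ a) ⟨
    resid (toℕ a + (N ∸ toℕ a))         ≡⟨ cong resid (ℕ.m+[n∸m]≡n (ℕ.<⇒≤ (Fin.toℕ<n a))) ⟩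
    resid N                             ≡⟨ resid-N ⟩
    𝟘 ∎
    where open ≡-Reasoning

  ⊕-inverseˡ : ∀ a → (⊖ a) ⊕ a ≡ 𝟘
  ⊕-inverseˡ a = trans (⊕-comm (⊖ a) a) (⊕-inverseʳ a)

  ⊕-cancelʳ : ∀ {a b} c → a ⊕ c ≡ b ⊕ c → a ≡ b
  ⊕-cancelʳ {a} {b} c e = begin
    a                  ≡⟨ ⊕-identityʳ a ⟨
    a ⊕ 𝟘              ≡⟨ cong (a ⊕_) (⊕-inverseʳ c) ⟨
    a ⊕ (c ⊕ (⊖ c))    ≡⟨ ⊕-assoc a c (⊖ c) ⟨
    (a ⊕ c) ⊕ (⊖ c)    ≡⟨ cong (_⊕ (⊖ c)) e ⟩
    (b ⊕ c) ⊕ (⊖ c)    ≡⟨ ⊕-assoc b c (⊖ c) ⟩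
    b ⊕ (c ⊕ (⊖ c))    ≡⟨ cong (b ⊕_) (⊕-inverseʳ c) ⟩
    b ⊕ 𝟘              ≡⟨ ⊕-identityʳ b ⟩
    b ∎
    where open ≡-Reasoning

  ⊕-interchange : ∀ a b c d → (a ⊕ b) ⊕ (c ⊕ d) ≡ (a ⊕ c) ⊕ (b ⊕ d)
  ⊕-interchange a b c d = begin
    (a ⊕ b) ⊕ (c ⊕ d)   ≡⟨ ⊕-assoc a b (c ⊕ d) ⟩
    a ⊕ (b ⊕ (c ⊕ d))   ≡⟨ cong (a ⊕_) (trans (sym (⊕-assoc b c d)) (trans (cong (_⊕ d) (⊕-comm b c)) (⊕-assoc c b d))) ⟩
    a ⊕ (c ⊕ (b ⊕ d))   ≡⟨ ⊕-assoc a c (b ⊕ d) ⟨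
    (a ⊕ c) ⊕ (b ⊕ d) ∎
    where open ≡-Reasoning

  -- A decision procedure for linear identities: an expression equals the difference of two
  -- combinations with coefficients in ℕ.

  infixl 6 _:⊕_
  infix 7 :⊖_

  data Expr (n : ℕ) : Set where
    var  : Fin n → Expr n
    :𝟘   : Expr n
    _:⊕_ : Expr n → Expr n → Expr n
    :⊖_  : Expr n → Expr n

  :diff : ∀ {n} → Expr n → Expr n → Expr n
  :diff e f = f :⊕ (:⊖ e)

  module _ {n : ℕ} where

    ⟦_⟧ : Expr n → Vec (Fin N) n → Fin N
    ⟦ var i ⟧ ρ = Vec.lookup ρ i
    ⟦ :𝟘 ⟧ ρ = 𝟘
    ⟦ e :⊕ f ⟧ ρ = ⟦ e ⟧ ρ ⊕ ⟦ f ⟧ ρ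
    ⟦ :⊖ e ⟧ ρ = ⊖ ⟦ e ⟧ ρ

    unit : ∀ {n} → Fin n → Vec ℕ n
    unit zero = 1 ∷ replicate _ 0
    unit (suc i) = 0 ∷ unit i

    pos neg : Expr n → Vec ℕ n
    pos (var i) = unit i
    pos :𝟘 = replicate n 0
    pos (e :⊕ f) = zipWith _+_ (pos e) (pos f)
    pos (:⊖ e) = neg e
    neg (var i) = replicate n 0
    neg :𝟘 = replicate n 0
    neg (e :⊕ f) = zipWith _+_ (neg e) (neg f)
    neg (:⊖ e) = pos e

  times : ℕ → Fin N → Fin N
  times zero g = 𝟘
  times (suc j) g = g ⊕ times j g

  times-+ : ∀ i j g → times (i + j) g ≡ times i g ⊕ times j g
  times-+ zero j g = sym (⊕-identityˡ _)
  times-+ (suc i) j g = trans (cong (g ⊕_) (times-+ i j g)) (sym (⊕-assoc g _ _))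

  comb : ∀ {n} → Vec ℕ n → Vec (Fin N) n → Fin N
  comb [] [] = 𝟘
  comb (j ∷ js) (g ∷ gs) = times j g ⊕ comb js gs

  comb-+ : ∀ {n} (u v : Vec ℕ n) gs → comb (zipWith _+_ u v) gs ≡ comb u gs ⊕ comb v gs
  comb-+ [] [] [] = sym (⊕-identityˡ _)
  comb-+ (i ∷ u) (j ∷ v) (g ∷ gs) =
    trans (cong₂ _⊕_ (times-+ i j g) (comb-+ u v gs)) (⊕-interchange (times i g) (times j g) (comb u gs) (comb v gs))

  comb-0 : ∀ {n} (gs : Vec (Fin N) n) → comb (replicate n 0) gs ≡ 𝟘
  comb-0 [] = refl
  comb-0 (g ∷ gs) = trans (⊕-identityˡ _) (comb-0 gs)

  comb-unit : ∀ {n} (i : Fin n) gs → comb (unit {n} i) gs ≡ Vec.lookup gs i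
  comb-unit zero (g ∷ gs) = trans (cong₂ _⊕_ (⊕-identityʳ g) (comb-0 gs)) (⊕-identityʳ g)
  comb-unit (suc i) (g ∷ gs) = trans (⊕-identityˡ _) (comb-unit i gs)

  expr-split : ∀ {n} (e : Expr n) ρ → ⟦ e ⟧ ρ ⊕ comb (neg e) ρ ≡ comb (pos e) ρ
  expr-split (var i) ρ = trans (cong (Vec.lookup ρ i ⊕_) (comb-0 ρ)) (trans (⊕-identityʳ _) (sym (comb-unit i ρ)))
  expr-split :𝟘 ρ = ⊕-identityˡ _
  expr-split (e :⊕ f) ρ = begin
    (⟦ e ⟧ ρ ⊕ ⟦ f ⟧ ρ) ⊕ comb (zipWith _+_ (neg e) (neg f)) ρ    ≡⟨ cong ((⟦ e ⟧ ρ ⊕ ⟦ f ⟧ ρ) ⊕_) (comb-+ (neg e) (neg f) ρ) ⟩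
    (⟦ e ⟧ ρ ⊕ ⟦ f ⟧ ρ) ⊕ (comb (neg e) ρ ⊕ comb (neg f) ρ)       ≡⟨ ⊕-interchange (⟦ e ⟧ ρ) (⟦ f ⟧ ρ) (comb (neg e) ρ) (comb (neg f) ρ) ⟩
    (⟦ e ⟧ ρ ⊕ comb (neg e) ρ) ⊕ (⟦ f ⟧ ρ ⊕ comb (neg f) ρ)       ≡⟨ cong₂ _⊕_ (expr-split e ρ) (expr-split f ρ) ⟩
    comb (pos e) ρ ⊕ comb (pos f) ρ                               ≡⟨ comb-+ (pos e) (pos f) ρ ⟨
    comb (zipWith _+_ (pos e) (pos f)) ρ ∎
    where open ≡-Reasoning
  expr-split (:⊖ e) ρ = begin
    (⊖ ⟦ e ⟧ ρ) ⊕ comb (pos e) ρ                     ≡⟨ cong ((⊖ ⟦ e ⟧ ρ) ⊕_) (expr-split e ρ) ⟨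
    (⊖ ⟦ e ⟧ ρ) ⊕ (⟦ e ⟧ ρ ⊕ comb (neg e) ρ)         ≡⟨ ⊕-assoc (⊖ ⟦ e ⟧ ρ) (⟦ e ⟧ ρ) (comb (neg e) ρ) ⟨
    ((⊖ ⟦ e ⟧ ρ) ⊕ ⟦ e ⟧ ρ) ⊕ comb (neg e) ρ         ≡⟨ cong (_⊕ comb (neg e) ρ) (⊕-inverseˡ (⟦ e ⟧ ρ)) ⟩
    𝟘 ⊕ comb (neg e) ρ                               ≡⟨ ⊕-identityˡ (comb (neg e) ρ) ⟩
    comb (neg e) ρ ∎
    where open ≡-Reasoning

  -- Adding the negative parts of `e` and `f` to both sides leaves combinations with natural
  -- coefficients. The hypothesis compares closed vectors, so `refl` proves it at each use.
  linear : ∀ {n} (ρ : Vec (Fin N) n) (e f : Expr n) →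
    zipWith _+_ (pos e) (neg f) ≡ zipWith _+_ (pos f) (neg e) → ⟦ e ⟧ ρ ≡ ⟦ f ⟧ ρ
  linear ρ e f eq = ⊕-cancelʳ (comb (neg e) ρ ⊕ comb (neg f) ρ) (begin
    E ⊕ (nE ⊕ nF)     ≡⟨ ⊕-assoc E nE nF ⟨
    (E ⊕ nE) ⊕ nF     ≡⟨ cong (_⊕ nF) (expr-split e ρ) ⟩
    comb (pos e) ρ ⊕ nF  ≡⟨ comb-+ (pos e) (neg f) ρ ⟨
    comb (zipWith _+_ (pos e) (neg f)) ρ ≡⟨ cong (λ v → comb v ρ) eq ⟩
    comb (zipWith _+_ (pos f) (neg e)) ρ ≡⟨ comb-+ (pos f) (neg e) ρ ⟩
    comb (pos f) ρ ⊕ nE  ≡⟨ cong (_⊕ nE) (expr-split f ρ) ⟨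
    (F ⊕ nF) ⊕ nE     ≡⟨ ⊕-assoc F nF nE ⟩
    F ⊕ (nF ⊕ nE)     ≡⟨ cong (F ⊕_) (⊕-comm nF nE) ⟩
    F ⊕ (nE ⊕ nF) ∎)
    where
    open ≡-Reasoning
    E F nE nF : Fin N
    E = ⟦ e ⟧ ρ
    F = ⟦ f ⟧ ρ
    nE = comb (neg e) ρ
    nF = comb (neg f) ρ

  v0 : ∀ {n} → Expr (1 + n)
  v0 = var zero
  v1 : ∀ {n} → Expr (2 + n)
  v1 = var (suc zero)
  v2 : ∀ {n} → Expr (3 + n)
  v2 = var (suc (suc zero))
  v3 : ∀ {n} → Expr (4 + n)
  v3 = var (suc (suc (suc zero)))
  v4 : ∀ {n} → Expr (5 + n)
  v4 = var (suc (suc (suc (suc zero))))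
  v5 : ∀ {n} → Expr (6 + n)
  v5 = var (suc (suc (suc (suc (suc zero)))))

  diff-self : ∀ a → diff a a ≡ 𝟘
  diff-self = ⊕-inverseʳ

  diff-𝟘 : ∀ a → diff 𝟘 a ≡ a
  diff-𝟘 a = linear (a ∷ []) (:diff :𝟘 v0) v0 refl

  diff-shift : ∀ a b g → diff (a ⊕ g) (b ⊕ g) ≡ diff a b
  diff-shift a b g = linear (a ∷ b ∷ g ∷ []) (:diff (v0 :⊕ v2) (v1 :⊕ v2)) (:diff v0 v1) refl

  diff-chain : ∀ a b c → diff a c ≡ diff a b ⊕ diff b c
  diff-chain a b c = linear (a ∷ b ∷ c ∷ []) (:diff v0 v2) (:diff v0 v1 :⊕ :diff v1 v2) refl

  diff-neg : ∀ a b → diff b a ≡ ⊖ diff a b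
  diff-neg a b = linear (a ∷ b ∷ []) (:diff v1 v0) (:⊖ :diff v0 v1) refl

  ⊕-diff : ∀ a b → a ⊕ diff a b ≡ b
  ⊕-diff a b = linear (a ∷ b ∷ []) (v0 :⊕ :diff v0 v1) v1 refl

  diff-⊕ : ∀ a g → diff a (a ⊕ g) ≡ g
  diff-⊕ a g = linear (a ∷ g ∷ []) (:diff v0 (v0 :⊕ v1)) v1 refl

  -- Congruence modulo a subgroup

  -- Wrapped in records because diff unfolds, so that its arguments could not be inferred.
  record _∼[_]_ (a : Fin N) (H : Subgroup) (b : Fin N) : Set where
    constructor mk∼
    field ∼-mem : diff a b ∈ᴴ H
  open _∼[_]_ public

  record Par (H : Subgroup) (a b c d : Fin N) : Set where
    constructor mk∥
    field ∥-mem : diff (diff a b) (diff c d) ∈ᴴ H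
  open Par public

  ∼? : ∀ H a b → Dec (a ∼[ H ] b)
  ∼? H a b = map′ mk∼ ∼-mem (mem H (diff a b) Bool.≟ true)

  Par? : ∀ H a b c d → Dec (Par H a b c d)
  Par? H a b c d = map′ mk∥ ∥-mem (mem H (diff (diff a b) (diff c d)) Bool.≟ true)

  module _ (H : Subgroup {k}) where

    ∈-≡ : ∀ {a b} → a ≡ b → b ∈ᴴ H → a ∈ᴴ H
    ∈-≡ refl p = p

    ∼-refl : ∀ {a} → a ∼[ H ] a
    ∼-refl {a} = mk∼ (∈-≡ (diff-self a) (has𝟘 H))

    ∼-sym : ∀ {a b} → a ∼[ H ] b → b ∼[ H ] a
    ∼-sym {a} {b} (mk∼ p) = mk∼ (∈-≡ (diff-neg a b) (closed⊖ H _ p))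

    ∼-trans : ∀ {a b c} → a ∼[ H ] b → b ∼[ H ] c → a ∼[ H ] c
    ∼-trans {a} {b} {c} (mk∼ p) (mk∼ q) = mk∼ (∈-≡ (diff-chain a b c) (closed⊕ H _ _ p q))

    ∥-refl : ∀ {a b} → Par H a b a b
    ∥-refl {a} {b} = mk∥ (∈-≡ (diff-self (diff a b)) (has𝟘 H))

    ∥-sym : ∀ {a b c d} → Par H a b c d → Par H c d a b
    ∥-sym {a} {b} {c} {d} (mk∥ p) = mk∥ (∈-≡ (diff-neg (diff a b) (diff c d)) (closed⊖ H _ p))

    ∥-trans : ∀ {a b c d e f} → Par H a b c d → Par H c d e f → Par H a b e f
    ∥-trans {a} {b} {c} {d} {e} {f} (mk∥ p) (mk∥ q) = mk∥ (∈-≡ (diff-chain (diff a b) (diff c d) (diff e f)) (closed⊕ H _ _ p q))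

    ∥-chain : ∀ {a b c a′ b′ c′} → Par H a b a′ b′ → Par H b c b′ c′ → Par H a c a′ c′
    ∥-chain {a} {b} {c} {a′} {b′} {c′} (mk∥ p) (mk∥ q) = mk∥ (∈-≡
      (linear (a ∷ b ∷ c ∷ a′ ∷ b′ ∷ c′ ∷ []) (:diff (:diff v0 v2) (:diff v3 v5))
        (:diff (:diff v0 v1) (:diff v3 v4) :⊕ :diff (:diff v1 v2) (:diff v4 v5)) refl) (closed⊕ H _ _ p q))

    ∥-flip : ∀ {a b a′ b′} → Par H a b a′ b′ → Par H b a b′ a′
    ∥-flip {a} {b} {a′} {b′} (mk∥ p) = mk∥ (∈-≡
      (linear (a ∷ b ∷ a′ ∷ b′ ∷ []) (:diff (:diff v1 v0) (:diff v3 v2)) (:⊖ :diff (:diff v0 v1) (:diff v2 v3)) refl) (closed⊖ H _ p))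

    ∥-diagonal : ∀ {a b} → Par H a a b b
    ∥-diagonal {a} {b} = mk∥ (∈-≡ (linear (a ∷ b ∷ []) (:diff (:diff v0 v0) (:diff v1 v1)) :𝟘 refl) (has𝟘 H))

    ∼→∥ : ∀ {a b c d} → a ∼[ H ] b → c ∼[ H ] d → Par H a c b d
    ∼→∥ {a} {b} {c} {d} (mk∼ p) (mk∼ q) = mk∥ (∈-≡
      (linear (a ∷ b ∷ c ∷ d ∷ []) (:diff (:diff v0 v2) (:diff v1 v3)) (:⊖ :diff v0 v1 :⊕ :diff v2 v3) refl)
      (closed⊕ H _ _ (closed⊖ H _ p) q))

    ∥→∼ : ∀ {a b c d} → Par H a b c d → a ∼[ H ] c → b ∼[ H ] d
    ∥→∼ {a} {b} {c} {d} (mk∥ p) (mk∼ q) = mk∼ (∈-≡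
      (linear (a ∷ b ∷ c ∷ d ∷ []) (:diff v1 v3) (:diff v0 v2 :⊕ :diff (:diff v0 v1) (:diff v2 v3)) refl) (closed⊕ H _ _ q p))

    ∥-∼ : ∀ {a b c d} → Par H a b c d → a ∼[ H ] b → c ∼[ H ] d
    ∥-∼ {a} {b} {c} {d} (mk∥ p) (mk∼ q) = mk∼ (∈-≡
      (linear (a ∷ b ∷ c ∷ d ∷ []) (:diff v2 v3) (:diff v0 v1 :⊕ :diff (:diff v0 v1) (:diff v2 v3)) refl) (closed⊕ H _ _ q p))

    ∥-translate : ∀ {a b} c → Par H a b c (c ⊕ diff a b)
    ∥-translate {a} {b} c = mk∥ (∈-≡
      (linear (a ∷ b ∷ c ∷ []) (:diff (:diff v0 v1) (:diff v2 (v2 :⊕ :diff v0 v1))) :𝟘 refl) (has𝟘 H))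

  -- A subgroup consists of the multiples of its least positive element; this element and hence
  -- the subgroup is determined by its order.

  module _ (H : Subgroup {k}) where

    private
      Ĥ : ℕ → Set
      Ĥ n = resid n ∈ᴴ H

    hat-+ : ∀ m n → Ĥ m → Ĥ n → Ĥ (m + n)
    hat-+ m n p q = ∈-≡ H (resid-+ m n) (closed⊕ H _ _ p q)

    hat-cancel : ∀ m n → Ĥ (m + n) → Ĥ n → Ĥ m
    hat-cancel m n p q = ∈-≡ H
      (trans (linear (resid m ∷ resid n ∷ []) v0 ((v0 :⊕ v1) :⊕ (:⊖ v1)) refl) (cong (_⊕ (⊖ resid n)) (sym (resid-+ m n))))
      (closed⊕ H _ _ p (closed⊖ H _ q))

    hat-* : ∀ j d → Ĥ d → Ĥ (j * d)
    hat-* zero d p = has𝟘 H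
    hat-* (suc j) d p = hat-+ d (j * d) p (hat-* j d p)

    Least : ℕ → Set
    Least d = Ĥ d × ∀ e → 0 < e → e < d → ¬ Ĥ e

    least : ∀ b → (∃[ d ] (0 < d × d ≤ b × Least d)) ⊎ (∀ e → 0 < e → e ≤ b → ¬ Ĥ e)
    least zero = inj₂ (λ e 0<e e≤0 _ → ℕ.<⇒≱ 0<e e≤0)
    least (suc b) with least b
    ... | inj₁ (d , 0<d , d≤b , l) = inj₁ (d , 0<d , ℕ.m≤n⇒m≤1+n d≤b , l)
    ... | inj₂ none with mem H (resid (suc b)) Bool.≟ true
    ...   | yes p = inj₁ (suc b , s≤s z≤n , ℕ.≤-refl , p , λ e 0<e e<d → none e 0<e (s≤s⁻¹ e<d))
    ...   | no ¬p = inj₂ λ e 0<e e≤ → none′ (ℕ.m≤n⇒m<n∨m≡n e≤) 0<e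
      where
      none′ : ∀ {e} → e < suc b ⊎ e ≡ suc b → 0 < e → ¬ Ĥ e
      none′ (inj₁ lt) 0<e = none _ 0<e (s≤s⁻¹ lt)
      none′ (inj₂ refl) _ = ¬p

    generator : ∃[ d ] (0 < d × (∀ n → Ĥ n → d ∣ n) × (∀ n → d ∣ n → Ĥ n))
    generator with least N
    -- `N` itself represents `𝟘`, so the search up to `N` cannot fail.
    ... | inj₂ none = ⊥-elim (none N (s≤s z≤n) ℕ.≤-refl (∈-≡ H resid-N (has𝟘 H)))
    ... | inj₁ (suc d , 0<d , _ , Ĥd , min) = suc d , 0<d , dvd , (λ { n (divides j refl) → hat-* j (suc d) Ĥd })
      where
      dvd : ∀ n → Ĥ n → suc d ∣ n
      dvd n p with n % suc d in eq
      ... | zero = m%n≡0⇒n∣m n (suc d) eq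
      ... | suc r = ⊥-elim (min (suc r) (s≤s z≤n) (subst (_< suc d) eq (m%n<n n (suc d)))
        (hat-cancel (suc r) (n / suc d * suc d)
          (subst Ĥ (trans (m≡m%n+[m/n]*n n (suc d)) (cong (_+ n / suc d * suc d) eq)) p) (hat-* (n / suc d) (suc d) Ĥd)))

  private
    -- `H` contains the `q` multiples of `d` below `N`; `f` sends them injectively to multiples of
    -- `d′` below `N`, of which there are `q′`.
    generator-≤ : ∀ H K (f : Fin N → Fin N) → (∀ {a b} → f a ≡ f b → a ≡ b) → (∀ g → g ∈ᴴ H → f g ∈ᴴ K) →
      ∀ q d q′ d′ → N ≡ q * d → N ≡ q′ * d′ → 0 < d → (∀ n → d ∣ n → resid n ∈ᴴ H) → (∀ n → resid n ∈ᴴ K → d′ ∣ n) → q ≤ q′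
    generator-≤ H K f inj f∈ q d q′ d′ Nq Nq′ 0<d H-d K-d = Fin.injective⇒≤ {f = h} h-inj
      where
      lt : ∀ (i : Fin q) → toℕ i * d < N
      lt i = subst (toℕ i * d <_) (sym Nq) (ℕ.*-monoˡ-< d {{>-nonZero 0<d}} (Fin.toℕ<n i))
      pt : Fin q → Fin N
      pt i = f (resid (toℕ i * d))
      dv : ∀ i → d′ ∣ toℕ (pt i)
      dv i = K-d _ (∈-≡ K (resid-toℕ (pt i)) (f∈ _ (H-d _ (n∣m*n (toℕ i)))))
      quot-lt : ∀ i → _∣_.quotient (dv i) < q′
      quot-lt i = ℕ.*-cancelʳ-< d′ _ _ (subst₂ _<_ (_∣_.equality (dv i)) Nq′ (Fin.toℕ<n (pt i)))
      h : Fin q → Fin q′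
      h i = fromℕ< (quot-lt i)
      h-inj : ∀ {i j} → h i ≡ h j → i ≡ j
      h-inj {i} {j} e = Fin.toℕ-injective (ℕ.*-cancelʳ-≡ _ _ d {{>-nonZero 0<d}} (begin
        toℕ i * d               ≡⟨ m<n⇒m%n≡m (lt i) ⟨
        toℕ i * d % N           ≡⟨ toℕ-resid (toℕ i * d) ⟨
        toℕ (resid (toℕ i * d)) ≡⟨ cong toℕ (inj (Fin.toℕ-injective same)) ⟩
        toℕ (resid (toℕ j * d)) ≡⟨ toℕ-resid (toℕ j * d) ⟩
        toℕ j * d % N           ≡⟨ m<n⇒m%n≡m (lt j) ⟩
        toℕ j * d               ∎))
        where
        open ≡-Reasoning
        same : toℕ (pt i) ≡ toℕ (pt j)
        same = trans (_∣_.equality (dv i)) (trans (cong (_* d′)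
          (trans (sym (Fin.toℕ-fromℕ< (quot-lt i))) (trans (cong toℕ e) (Fin.toℕ-fromℕ< (quot-lt j))))) (sym (_∣_.equality (dv j))))

  -- The comparison for `π` and for its inverse gives `q ≡ q′`, and `q * d ≡ N ≡ q * d′` then
  -- identifies the generators. Here it matters that the group is cyclic.
  equal-order⇒≐ : ∀ H K (π : Fin N ↔ Fin N) → (∀ g → mem K (Inverse.to π g) ≡ mem H g) → H ≐ᴴ K
  equal-order⇒≐ H K π HK with generator H | generator K
  ... | d , 0<d , H→d , d→H | d′ , 0<d′ , K→d , d→K = same (H→d N (∈-≡ H resid-N (has𝟘 H))) (K→d N (∈-≡ K resid-N (has𝟘 K)))
    where
    to-inj : ∀ {a b} → Inverse.to π a ≡ Inverse.to π b → a ≡ b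
    to-inj {a} {b} e = trans (sym (Inverse.strictlyInverseʳ π a)) (trans (cong (Inverse.from π) e) (Inverse.strictlyInverseʳ π b))
    from-inj : ∀ {a b} → Inverse.from π a ≡ Inverse.from π b → a ≡ b
    from-inj {a} {b} e = trans (sym (Inverse.strictlyInverseˡ π a)) (trans (cong (Inverse.to π) e) (Inverse.strictlyInverseˡ π b))
    same : d ∣ N → d′ ∣ N → H ≐ᴴ K
    same (divides q Nq) (divides q′ Nq′) g = Bool.⇔→≡ {z = true} (mk⇔ (λ p → subst (_∈ᴴ K) (resid-toℕ g) (d→K _ (subst (_∣ toℕ g) d≡d′ (H→d _ (∈-≡ H (resid-toℕ g) p)))))
      (λ p → subst (_∈ᴴ H) (resid-toℕ g) (d→H _ (subst (_∣ toℕ g) (sym d≡d′) (K→d _ (∈-≡ K (resid-toℕ g) p))))))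
      where
      q≡q′ : q ≡ q′
      q≡q′ = ℕ.≤-antisym
        (generator-≤ H K (Inverse.to π) to-inj (λ a p → trans (HK a) p) q d q′ d′ Nq Nq′ 0<d d→H K→d)
        (generator-≤ K H (Inverse.from π) from-inj (λ a p → trans (sym (HK (Inverse.from π a))) (trans (cong (mem K) (Inverse.strictlyInverseˡ π a)) p)) q′ d′ q d Nq′ Nq 0<d′ d→K H→d)
      q≢0 : ∀ j → N ≡ j * d → NonZero j
      q≢0 (suc j) _ = _
      d≡d′ : d ≡ d′
      d≡d′ = ℕ.*-cancelˡ-≡ d d′ q {{q≢0 q Nq}} (trans (sym Nq) (trans Nq′ (cong (_* d′) (sym q≡q′))))

-- The Weisfeiler–Leman equivalence

module _ {k : ℕ} where

  private
    N : ℕ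
    N = suc k

  module _ {m : ℕ} where

    upd-same : ∀ (x : Tup {k} m) i α → upd x i α i ≡ α
    upd-same x i α with i ≟ i
    ... | yes _ = refl
    ... | no i≢i = ⊥-elim (i≢i refl)

    upd-other : ∀ (x : Tup {k} m) i α j → i ≢ j → upd x i α j ≡ x j
    upd-other x i α j i≢j with i ≟ j
    ... | yes i≡j = ⊥-elim (i≢j i≡j)
    ... | no _ = refl

    upd-map : ∀ (f : Fin N → Fin N) {x y : Tup {k} m} → (∀ j → y j ≡ f (x j)) → ∀ i α j → upd y i (f α) j ≡ f (upd x i α j)
    upd-map f e i α j with i ≟ j
    ... | yes _ = refl
    ... | no _ = e j

    upd-cong : ∀ {x y : Tup {k} m} → x ≗ y → ∀ i α → upd x i α ≗ upd y i α
    upd-cong e i α j with i ≟ j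
    ... | yes _ = refl
    ... | no _ = e j

  record Automorphism (X : Scheme {k}) : Set where
    constructor automorphism
    field
      bij       : Fin N ↔ Fin N
      invariant : ∀ α β → c X (Inverse.to bij α) (Inverse.to bij β) ≡ c X α β
  open Automorphism public

  identity : ∀ {X} → Automorphism X
  identity = automorphism (↔-id _) (λ _ _ → refl)

  module _ (X : Scheme {k}) {m : ℕ} where

    private
      T : Set
      T = Tup {k} m

    WLeq-resp : ∀ t {x x′ y y′ : T} → x ≗ x′ → y ≗ y′ → WLeq X t x y → WLeq X t x′ y′
    WLeq-resp zero e f h i j = trans (sym (cong₂ (c X) (e i) (e j))) (trans (h i j) (cong₂ (c X) (f i) (f j)))
    WLeq-resp (suc t) e f (h , π , step) = WLeq-resp t e f h , π ,
      λ α i → WLeq-resp t (upd-cong e i α) (upd-cong f i (Inverse.to π α)) (step α i)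

    -- In every round the automorphism itself serves as the bijection; reflexivity is the case of
    -- the identity.
    WLeq-aut : (f : Automorphism X) → ∀ t {x y : T} → (∀ j → y j ≡ Inverse.to (bij f) (x j)) → WLeq X t x y
    WLeq-aut f zero e i j = sym (trans (cong₂ (c X) (e i) (e j)) (invariant f _ _))
    WLeq-aut f (suc t) e = WLeq-aut f t e , bij f , λ α i → WLeq-aut f t (upd-map (Inverse.to (bij f)) e i α)

    WLeq-refl : ∀ t (x : T) → WLeq X t x x
    WLeq-refl t x = WLeq-aut identity t (λ _ → refl)

    WLeq-sym : ∀ t {x y : T} → WLeq X t x y → WLeq X t y x
    WLeq-sym zero h i j = sym (h i j)
    WLeq-sym (suc t) {x} {y} (h , π , step) = WLeq-sym t h , ↔-sym π , λ α i → WLeq-sym t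
      (subst (λ β → WLeq X t (upd x i (Inverse.from π α)) (upd y i β)) (Inverse.strictlyInverseˡ π α) (step (Inverse.from π α) i))

    WLeq-trans : ∀ t {x y z : T} → WLeq X t x y → WLeq X t y z → WLeq X t x z
    WLeq-trans zero h g i j = trans (h i j) (g i j)
    WLeq-trans (suc t) (h , π , step) (h′ , π′ , step′) = WLeq-trans t h h′ , (π′ ↔-∘ π) ,
      λ α i → WLeq-trans t (step α i) (step′ (Inverse.to π α) i)

    private
      Row : ℕ → T → T → Fin N → Fin N → Set
      Row t x y α β = ∀ i → WLeq X t (upd x i α) (upd y i β)

      Row-difun : ∀ t {x y} → Difunctional (Row t x y)
      Row-difun t p q r i = WLeq-trans t (p i) (WLeq-trans t (WLeq-sym t (q i)) (r i))

    -- A round asks for a bijection inside a relation that is difunctional because the previous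
    -- round is an equivalence; `Matching` decides whether there is one.
    WLeq? : ∀ t (x y : T) → Dec (WLeq X t x y)
    WLeq? zero x y = all? (λ i → all? (λ j → c X (x i) (x j) ≟ c X (y i) (y j)))
    WLeq? (suc t) x y = WLeq? t x y ×-dec
      Matching.perfect? {P = Row t x y} (λ α β → all? (λ i → WLeq? t (upd x i α) (upd y i β))) (λ {a} {b} {a′} {b′} → Row-difun t {x} {y} {a} {b} {a′} {b′})

    Stable : ℕ → Set
    Stable t = ∀ (x y : T) → WLeq X t x y → WLeq X (suc t) x y

    private
      M : ℕ
      M = N ^ m

      E : ℕ → Fin (M * M) → Set
      E t p = WLeq X t (finToFun {N} {m} (proj₁ (remQuot {M} M p))) (finToFun {N} {m} (proj₂ (remQuot {M} M p)))

      E? : ∀ t p → Dec (E t p)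
      E? t p = WLeq? t _ _

      left : ∀ (x y : T) → finToFun (proj₁ (remQuot {M} M (combine (funToFin x) (funToFin y)))) ≗ x
      left x y j = trans (cong (λ p → finToFun (proj₁ p) j) (Fin.remQuot-combine {M} {M} (funToFin x) (funToFin y))) (Fin.finToFun-funToFin x j)

      right : ∀ (x y : T) → finToFun (proj₂ (remQuot {M} M (combine (funToFin x) (funToFin y)))) ≗ y
      right x y j = trans (cong (λ p → finToFun (proj₂ p) j) (Fin.remQuot-combine {M} {M} (funToFin x) (funToFin y))) (Fin.finToFun-funToFin y j)

      encode : ∀ t {x y : T} → WLeq X t x y → E t (combine (funToFin x) (funToFin y))
      encode t {x} {y} = WLeq-resp t (λ j → sym (left x y j)) (λ j → sym (right x y j))

      decode : ∀ t {x y : T} → E t (combine (funToFin x) (funToFin y)) → WLeq X t x y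
      decode t {x} {y} = WLeq-resp t (left x y) (right x y)

      -- An unstable round removes at least one pair from the finite set of coded equivalent pairs,
      -- so it suffices that `fuel` exceeds their number.
      search : ∀ fuel t → # (E? t) < fuel → ∃ Stable
      search (suc fuel) t lt with all? (λ p → E? t p →-dec E? (suc t) p)
      ... | yes st = t , λ x y h → decode (suc t) (st _ (encode t h))
      ... | no ¬st with Fin.¬∀⟶∃¬ _ _ (λ p → E? t p →-dec E? (suc t) p) ¬st
      ...   | p , ¬imp = search fuel (suc t) (ℕ.<-≤-trans (#-strict (E? (suc t)) (E? t) (λ _ → proj₁) p Ep (λ e → ¬imp (λ _ → e))) (s≤s⁻¹ lt))
        where
        Ep : E t p
        Ep with E? t p
        ... | yes e = e
        ... | no ¬e = ⊥-elim (¬imp (λ e → ⊥-elim (¬e e)))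

    stable : ∃ Stable
    stable = search (suc (# (E? 0))) 0 ℕ.≤-refl

    private
      T₀ : ℕ
      T₀ = proj₁ stable

      stable-+ : ∀ s → Stable (s + T₀)
      stable-+ zero = proj₂ stable
      stable-+ (suc s) x y (h , π , step) = (h , π , step) , π , λ α i → stable-+ s _ _ (step α i)

      grow : ∀ s {x y : T} → WLeq X T₀ x y → WLeq X (s + T₀) x y
      grow zero h = h
      grow (suc s) h = stable-+ s _ _ (grow s h)

      shrink : ∀ t s {x y : T} → WLeq X (s + t) x y → WLeq X t x y
      shrink t zero h = h
      shrink t (suc s) h = shrink t s (proj₁ h)

      WLeq→≈ : ∀ {x y : T} → WLeq X T₀ x y → x ≈[ X ] y
      WLeq→≈ {x} {y} h t = shrink t T₀ (subst (λ s → WLeq X s x y) (ℕ.+-comm t T₀) (grow t h))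

    ≈? : ∀ (x y : T) → Dec (x ≈[ X ] y)
    ≈? x y = map′ WLeq→≈ (λ h → h T₀) (WLeq? T₀ x y)

    ≈-sym : ∀ {x y : T} → x ≈[ X ] y → y ≈[ X ] x
    ≈-sym h t = WLeq-sym t (h t)

    ≈-trans : ∀ {x y z : T} → x ≈[ X ] y → y ≈[ X ] z → x ≈[ X ] z
    ≈-trans h g t = WLeq-trans t (h t) (g t)

    -- Each round comes with a bijection of its own. The one from the round after the stable round
    -- works for all rounds at once.
    ≈-step : ∀ {x y : T} → x ≈[ X ] y → Σ (Fin N ↔ Fin N) λ π → ∀ α i → upd x i α ≈[ X ] upd y i (Inverse.to π α)
    ≈-step h = let _ , π , step = h (suc T₀) in π , λ α i → WLeq→≈ (step α i)

    ≗→≈ : ∀ {x y : T} → x ≗ y → x ≈[ X ] y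
    ≗→≈ e t = WLeq-aut identity t (λ j → sym (e j))

  -- The pairs of positions from which Duplicator survives in the bijective pebble game, in a form that
  -- covers both the classes of WL(X) and the algebraic automorphisms of WL(X).
  record Game (X : Scheme {k}) (m : ℕ) (Q : Tup {k} m → Tup {k} m → Set) : Set where
    field
      decide : ∀ x y → Dec (Q x y)
      difun  : Difunctional Q
      autˡ   : ∀ (f : Automorphism X) {x x′ y} → (∀ j → x′ j ≡ Inverse.to (bij f) (x j)) → Q x y → Q x′ y
      autʳ   : ∀ (f : Automorphism X) {x y y′} → (∀ j → y′ j ≡ Inverse.to (bij f) (y j)) → Q x y → Q x y′
      move   : ∀ {x y} → Q x y → Σ (Fin N ↔ Fin N) λ π → ∀ α i → Q (upd x i α) (upd y i (Inverse.to π α))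

  ≈-game : ∀ X m → Game X m (_≈[ X ]_)
  ≈-game X m = record
    { decide = ≈? X
    ; difun  = λ p q r → ≈-trans X p (≈-trans X (≈-sym X q) r)
    ; autˡ   = λ f e p → ≈-trans X (≈-sym X (λ t → WLeq-aut X f t e)) p
    ; autʳ   = λ f e p → ≈-trans X p (λ t → WLeq-aut X f t e)
    ; move   = ≈-step X
    }

  -- Algebraic automorphisms of WL(X) as pebble games.

  module _ {X : Scheme {k}} {m′ : ℕ} {φ : AlgAut X} (W : WLSelfEquiv X m′ φ) where

    open WLSelfEquiv W

    private
      m : ℕ
      m = suc (suc m′)

    -- `total` selects one image of `x`; the others are exactly the members of its class, and `≈?`
    -- decides membership.
    R? : ∀ x y → Dec (R x y)
    R? x y = map′ (λ h → resp x x _ y (≈-refl x) h (proj₂ (total x))) (λ h → func x _ y (proj₂ (total x)) h)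
                  (≈? X (proj₁ (total x)) y)
      where
      ≈-refl : ∀ x → x ≈[ X ] x
      ≈-refl x t = WLeq-refl X t x

    R-game : Game X m R
    R-game = record
      { decide = R?
      ; difun  = R-difun
      ; autˡ   = λ f {x} {x′} {y} e p → resp x x′ y y (λ t → WLeq-aut X f t e) (λ t → WLeq-refl X t y) p
      ; autʳ   = λ f {x} {y} {y′} e p → resp x x y y′ (λ t → WLeq-refl X t x) (λ t → WLeq-aut X f t e) p
      ; move   = R-move
      }
      where
      R-difun : Difunctional R
      R-difun {a} {b} {a′} {b′} p q r = resp a a b b′ (λ t → WLeq-refl X t a) (func a′ b b′ q r) p
      -- `numbers` gives a separate bijection for each choice of classes. Only the existence of
      -- answers and the equality of counts are kept, and `Matching` assembles one bijection for all
      -- points.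
      R-move : ∀ {x y} → R x y → Σ (Fin N ↔ Fin N) λ π → ∀ α i → R (upd x i α) (upd y i (Inverse.to π α))
      R-move {x} {y} Rxy = balanced→perfect (tot , bal)
        where
        P : Fin N → Fin N → Set
        P α β = ∀ i → R (upd x i α) (upd y i β)
        P? : ∀ α β → Dec (P α β)
        P? α β = all? (λ i → R? (upd x i α) (upd y i β))
        P-difun : Difunctional P
        P-difun p q r i = R-difun (p i) (q i) (r i)
        open Matching {P = P} P? (λ {a} {b} {a′} {b′} → P-difun {a} {b} {a′} {b′})
        tot : ∀ α → ∃[ β ] P α β
        tot α = let π , h = numbers x y Rxy (λ i → upd x i α) (λ i → proj₁ (total (upd x i α))) (λ i → proj₂ (total (upd x i α))) in
          Inverse.to π α , λ i → resp _ _ _ _ (λ t → WLeq-refl X t _)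
            (≈-sym X (Equivalence.to (h α) (λ i t → WLeq-refl X t _) i)) (proj₂ (total (upd x i α)))
        bal : ∀ α β → P α β → # (P? α) ≡ # (λ α′ → P? α′ β)
        bal α β p = let π , h = numbers x y Rxy (λ i → upd x i α) (λ i → upd y i β) p in
          sym (#-bijection (λ α′ → P? α′ β) (P? α) π
            (λ α′ q i → resp _ _ _ _ (λ t → WLeq-refl X t _) (≈-sym X (Equivalence.to (h α′) (λ i → inj _ _ _ (q i) (p i)) i)) (p i))
            (λ α′ q i → resp _ _ _ _ (≈-sym X (Equivalence.from (h α′) (λ i → func _ _ _ (q i) (p i)) i)) (λ t → WLeq-refl X t _) (p i)))

    coord-eq : ∀ {x y} → R x y → ∀ i j → c X (y i) (y j) ≡ app φ (c X (x i) (x j))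
    coord-eq {x} {y} p i j = proj₂-agrees _ _ (coord σ x y p)
      where
      σ : Fin m → Fin m
      σ zero = i
      σ (suc _) = j

    -- A constant tuple is unchanged by the coordinate map that repeats its first entry, so its
    -- image has the class of the repeated image. The diagonal colours then force equal entries.
    R-const : ∀ {x y} → R x y → (∀ i j → x i ≡ x j) → ∀ i j → y i ≡ y j
    R-const {x} {y} p e i j = diagonal X _ _ _ _ (sym (h i j)) refl
      where
      h : ∀ i j → c X (y i) (y j) ≡ c X (y zero) (y zero)
      h i j = func x y (λ _ → y zero) p
        (resp _ _ _ _ (≗→≈ X (λ j → e zero j)) (λ t → WLeq-refl X t _) (coord (λ _ → zero) x y p)) 0 i j

    R-const⁻¹ : ∀ {x y} → R x y → (∀ i j → y i ≡ y j) → ∀ i j → x i ≡ x j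
    R-const⁻¹ {x} {y} p e i j = diagonal X _ _ _ _ (sym (h i j)) refl
      where
      h : ∀ i j → c X (x i) (x j) ≡ c X (x zero) (x zero)
      h i j = inj x (λ _ → x zero) y p
        (resp _ _ _ _ (λ t → WLeq-refl X t _) (≗→≈ X (λ j → e zero j)) (coord (λ _ → zero) x y p)) 0 i j

-- Lifting pebble games to the extension

module _ {k : ℕ} where

  private
    N : ℕ
    N = suc k

  translation : Fin N → Fin N ↔ Fin N
  translation a = mk↔ₛ′ (a ⊕_) (diff a) (⊕-diff a) (diff-⊕ a)

  record Swap (X : Scheme {k}) (U₀ : Subgroup) (a b : Fin N) : Set where
    field
      aut        : Automorphism X
    f : Fin N → Fin N
    f = Inverse.to (bij aut)
    field
      involutive : ∀ γ → f (f γ) ≡ γ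
      a→b        : ∀ {γ} → a ∼[ U₀ ] γ → b ∼[ U₀ ] f γ
      b→a        : ∀ {γ} → b ∼[ U₀ ] γ → a ∼[ U₀ ] f γ
      fixed      : ∀ {γ} → ¬ a ∼[ U₀ ] γ → ¬ b ∼[ U₀ ] γ → f γ ≡ γ

  Compatible : ∀ (U₁ U₀ : Subgroup {k}) {m} → Tup {k} m → Tup {k} m → Set
  Compatible U₁ U₀ x y = ∀ i j → x i ∼[ U₁ ] x j → Par U₀ (x i) (x j) (y i) (y j)

  module Lifting (X : Scheme {k}) (U₁ U₀ : Subgroup {k}) (U₀⊆U₁ : U₀ ⊆ᴴ U₁)
    (swap : ∀ a b → a ∼[ U₁ ] b → Swap X U₀ a b) where

    private
      0→1 : ∀ {a b} → a ∼[ U₀ ] b → a ∼[ U₁ ] b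
      0→1 (mk∼ p) = mk∼ (U₀⊆U₁ _ p)

      ∥0→1 : ∀ {a b c d} → Par U₀ a b c d → Par U₁ a b c d
      ∥0→1 (mk∥ p) = mk∥ (U₀⊆U₁ _ p)

      s₀ : ∀ {a b} → a ∼[ U₀ ] b → b ∼[ U₀ ] a
      s₀ = ∼-sym U₀
      s₁ : ∀ {a b} → a ∼[ U₁ ] b → b ∼[ U₁ ] a
      s₁ = ∼-sym U₁
      t₀ : ∀ {a b c} → a ∼[ U₀ ] b → b ∼[ U₀ ] c → a ∼[ U₀ ] c
      t₀ = ∼-trans U₀
      t₁ : ∀ {a b c} → a ∼[ U₁ ] b → b ∼[ U₁ ] c → a ∼[ U₁ ] c
      t₁ = ∼-trans U₁

    module _ {m : ℕ} (x : Tup {k} m) where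

      Free : Fin m → Fin N → Set
      Free j γ = x j ∼[ U₁ ] γ × (∀ i → ¬ x i ∼[ U₀ ] γ)

      Free? : ∀ j γ → Dec (Free j γ)
      Free? j γ = ∼? U₁ (x j) γ ×-dec all? (λ i → ¬? (∼? U₀ (x i) γ))

      Free-∼ : ∀ {j γ δ} → γ ∼[ U₀ ] δ → Free j γ → Free j δ
      Free-∼ γ∼δ (near , free) = t₁ near (0→1 γ∼δ) , λ i p → free i (t₀ p (s₀ γ∼δ))

      free-fixed : ∀ {j γ δ} → Free j γ → Free j δ → (S : Swap X U₀ γ δ) → ∀ i → Swap.f S (x i) ≡ x i
      free-fixed (_ , fγ) (_ , fδ) S i = Swap.fixed S (λ p → fγ i (s₀ p)) (λ p → fδ i (s₀ p))

      -- The swaps distribute a set invariant under the stabilizer of x evenly among the U₀-cosets in Free.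
      equidistributed : ∀ j {A : Fin N → Set} (A? : ∀ a → Dec (A a)) → (∀ {a} → A a → Free j a) →
        (∀ (f : Automorphism X) → (∀ i → Inverse.to (bij f) (x i) ≡ x i) → ∀ {a} → A a → A (Inverse.to (bij f) a)) →
        ∀ γ → Free j γ → # (Free? j) * # (λ a → A? a ×-dec ∼? U₀ γ a) ≡ # A? * # (∼? U₀ 𝟘)
      equidistributed j {A} A? A⊆ A-inv γ Fγ = double-count A? (Free? j) (∼? U₀) _ _ rows cols
        where
        rows : ∀ δ → Free j δ → # (λ a → A? a ×-dec ∼? U₀ δ a) ≡ # (λ a → A? a ×-dec ∼? U₀ γ a)
        rows δ Fδ = #-bijection (λ a → A? a ×-dec ∼? U₀ δ a) (λ a → A? a ×-dec ∼? U₀ γ a) (bij aut)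
          (λ a (Aa , δ∼a) → A-inv aut fix Aa , a→b δ∼a)
          (λ a (Afa , γ∼fa) → subst A (involutive a) (A-inv aut fix Afa) , subst (δ ∼[ U₀ ]_) (involutive a) (b→a γ∼fa))
          where
          S : Swap X U₀ δ γ
          S = swap δ γ (t₁ (s₁ (proj₁ Fδ)) (proj₁ Fγ))
          open Swap S
          fix : ∀ i → f (x i) ≡ x i
          fix = free-fixed Fδ Fγ S
        -- The whole `U₀`-coset of `a` is free because `a` is, so the count is the order of `U₀`.
        cols : ∀ a → A a → # (λ w → Free? j w ×-dec ∼? U₀ w a) ≡ # (∼? U₀ 𝟘)
        cols a Aa = sym (#-bijection (∼? U₀ 𝟘) (λ w → Free? j w ×-dec ∼? U₀ w a) (translation a)
          (λ v 0∼v → let a∼av = ∥-∼ U₀ (par v) 0∼v in Free-∼ a∼av (A⊆ Aa) , s₀ a∼av)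
          (λ v (_ , av∼a) → ∥-∼ U₀ (∥-sym U₀ (par v)) (s₀ av∼a)))
          where
          par : ∀ v → Par U₀ 𝟘 v a (a ⊕ v)
          par v = subst (λ u → Par U₀ 𝟘 v a (a ⊕ u)) (diff-𝟘 v) (∥-translate U₀ a)

    module _ {m′ : ℕ} {Q : Tup {k} (suc (suc m′)) → Tup {k} (suc (suc m′)) → Set} (𝒢 : Game X (suc (suc m′)) Q)
      (Q-U : ∀ U → U ≡ U₀ ⊎ U ≡ U₁ → ∀ {x y} → Q x y → ∀ i j → (x i ∼[ U ] x j) ⇔ (y i ∼[ U ] y j)) where

      open Game 𝒢

      private
        m : ℕ
        m = suc (suc m′)

        other : ∀ (j : Fin m) → ∃[ i ] i ≢ j
        other zero = suc zero , λ ()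
        other (suc j) = zero , λ ()

      module _ {x y : Tup {k} m} (Qxy : Q x y) (comp : Compatible U₁ U₀ x y) where

        private
          -- `PQ` collects the answers allowed by the given game, `C` those that keep the new pebble
          -- compatible with the old ones; the bijection is sought inside their conjunction `P`.
          PQ : Fin N → Fin N → Set
          PQ α β = ∀ i → Q (upd x i α) (upd y i β)

          PQ? : ∀ α β → Dec (PQ α β)
          PQ? α β = all? (λ i → decide _ _)

          PQ-difun : Difunctional PQ
          PQ-difun p q r i = difun (p i) (q i) (r i)

          C : Fin N → Fin N → Set
          C α β = ∀ j → x j ∼[ U₁ ] α → Par U₀ (x j) α (y j) β

          C? : ∀ α β → Dec (C α β)
          C? α β = all? (λ j → ∼? U₁ (x j) α →-dec Par? U₀ _ _ _ _)

          P : Fin N → Fin N → Set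
          P α β = PQ α β × C α β

          P? : ∀ α β → Dec (P α β)
          P? α β = PQ? α β ×-dec C? α β

          -- The point is placed at a position other than `j`, so that `x j` stays visible beside
          -- it; this takes two positions.
          PQ-U : ∀ U → U ≡ U₀ ⊎ U ≡ U₁ → ∀ {α β} → PQ α β → ∀ j → (x j ∼[ U ] α) ⇔ (y j ∼[ U ] β)
          PQ-U U U≡ {α} {β} p j = subst₂ _⇔_ (cong₂ (_∼[ U ]_) (upd-other x i α j i≢j) (upd-same x i α))
            (cong₂ (_∼[ U ]_) (upd-other y i β j i≢j) (upd-same y i β)) (Q-U U U≡ (p i) j i)
            where
            i : Fin m
            i = proj₁ (other j)
            i≢j : i ≢ j
            i≢j = proj₂ (other j)

          x→y₀ : ∀ {α β} → PQ α β → ∀ {j} → x j ∼[ U₀ ] α → y j ∼[ U₀ ] β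
          x→y₀ p {j} = Equivalence.to (PQ-U U₀ (inj₁ refl) p j)
          y→x₀ : ∀ {α β} → PQ α β → ∀ {j} → y j ∼[ U₀ ] β → x j ∼[ U₀ ] α
          y→x₀ p {j} = Equivalence.from (PQ-U U₀ (inj₁ refl) p j)
          x→y₁ : ∀ {α β} → PQ α β → ∀ {j} → x j ∼[ U₁ ] α → y j ∼[ U₁ ] β
          x→y₁ p {j} = Equivalence.to (PQ-U U₁ (inj₂ refl) p j)
          y→x₁ : ∀ {α β} → PQ α β → ∀ {j} → y j ∼[ U₁ ] β → x j ∼[ U₁ ] α
          y→x₁ p {j} = Equivalence.from (PQ-U U₁ (inj₂ refl) p j)

          P-difun : Difunctional P
          P-difun {α} {β} {α′} {β′} (p , cp) (q , cq) (r , cr) = PQ-difun {α} {β} {α′} {β′} p q r , λ j near →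
            let near′ = y→x₁ q (x→y₁ p near) in
            ∥-trans U₀ (cp j near) (∥-trans U₀ (∥-sym U₀ (cq j near′)) (cr j near′))

          open Matching {P = PQ} PQ? (λ {a} {b} {a′} {b′} → PQ-difun {a} {b} {a′} {b′})
            using () renaming (perfect→balanced to PQ-balanced)
          open Matching {P = P} P? (λ {a} {b} {a′} {b′} → P-difun {a} {b} {a′} {b′})
            using (balanced→perfect)

          π : Fin N ↔ Fin N
          π = proj₁ (move Qxy)

          PQ-π : ∀ α → PQ α (Inverse.to π α)
          PQ-π = proj₂ (move Qxy)

          PQ-bal : ∀ α β → PQ α β → # (PQ? α) ≡ # (λ α′ → PQ? α′ β)
          PQ-bal = proj₂ (PQ-balanced (move Qxy))

          -- Compatibility is a real constraint only in the case `free`: a far point is compared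
          -- with no entry, and a point in the `U₀`-coset of `x j` is always answered in that of
          -- `y j`.
          data Position (α : Fin N) : Set where
            far  : (∀ j → ¬ x j ∼[ U₁ ] α) → Position α
            hit  : ∀ j → x j ∼[ U₀ ] α → Position α
            free : ∀ j → Free x j α → Position α

          position : ∀ α → Position α
          position α with any? (λ j → ∼? U₀ (x j) α)
          ... | yes (j , p) = hit j p
          ... | no ∄₀ with any? (λ j → ∼? U₁ (x j) α)
          ...   | yes (j , p) = free j (p , λ i q → ∄₀ (i , q))
          ...   | no ∄₁ = far (λ j p → ∄₁ (j , p))

          C-far : ∀ {α β} → (∀ j → ¬ x j ∼[ U₁ ] α) → C α β
          C-far ¬near j near = ⊥-elim (¬near j near)

          C-hit : ∀ {α β} j → x j ∼[ U₀ ] α → PQ α β → C α β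
          C-hit j h p i near = ∥-chain U₀ (comp i j (t₁ near (0→1 (s₀ h))))
            (∥-trans U₀ (∼→∥ U₀ (∼-refl U₀) (s₀ h)) (∥-trans U₀ (∥-diagonal U₀) (∼→∥ U₀ (∼-refl U₀) (x→y₀ p h))))

          -- One reference entry suffices, since `comp` links it to every other entry of the same
          -- `U₁`-coset.
          C-base : ∀ {α β} j → Par U₀ (x j) α (y j) β → x j ∼[ U₁ ] α → C α β
          C-base j p near i near′ = ∥-chain U₀ (comp i j (t₁ near′ (s₁ near))) p

          tot : ∀ α → ∃[ β ] P α β
          tot α with position α
          ... | far ¬near = Inverse.to π α , PQ-π α , C-far ¬near
          ... | hit j h = Inverse.to π α , PQ-π α , C-hit j h (PQ-π α)
          -- The answer `β₀` lies in the right `U₁`-coset but perhaps in a wrong `U₀`-coset; `b`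
          -- marks the right one. Neither `U₀`-coset meets `y`, so the swap corrects the answer
          -- without moving a pebble.
          ... | free j (near , ¬hit) = f β₀ , (λ i → autʳ aut (λ l → fix i l) (PQ-π α i)) , C-base j (∥-trans U₀ par (∼→∥ U₀ (∼-refl U₀) (a→b (∼-refl U₀)))) near
            where
            β₀ b : Fin N
            β₀ = Inverse.to π α
            b = y j ⊕ diff (x j) α
            par : Par U₀ (x j) α (y j) b
            par = ∥-translate U₀ (y j)
            y∼b : y j ∼[ U₁ ] b
            y∼b = ∥-∼ U₁ (∥0→1 par) near
            S : Swap X U₀ β₀ b
            S = swap β₀ b (t₁ (s₁ (x→y₁ (PQ-π α) near)) y∼b)
            open Swap S
            -- A pebble `y i` in the coset of `b` would, by compatibility, put `x i` into the coset
            -- of `α`.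
            ¬b : ∀ i → ¬ b ∼[ U₀ ] y i
            ¬b i b∼y = ¬hit i (∥→∼ U₀
              (∥-trans U₀ (comp j i xj∼xi) (∥-trans U₀ (∼→∥ U₀ (∼-refl U₀) (s₀ b∼y)) (∥-sym U₀ par))) (∼-refl U₀))
              where
              xj∼xi : x j ∼[ U₁ ] x i
              xj∼xi = Equivalence.from (Q-U U₁ (inj₂ refl) Qxy j i) (t₁ y∼b (0→1 b∼y))
            fix : ∀ i l → upd y i (f β₀) l ≡ f (upd y i β₀ l)
            fix i = upd-map f (λ l → sym (fixed (λ p → ¬hit l (y→x₀ (PQ-π α) (s₀ p))) (¬b l))) i β₀

          bal : ∀ α β → P α β → # (P? α) ≡ # (λ α′ → P? α′ β)
          bal α β (p , cαβ) with position α
          ... | far ¬near = trans (#-cong (P? α) (PQ? α) (λ _ → proj₁) (λ _ q → q , C-far ¬near))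
            (trans (PQ-bal α β p) (#-cong (λ α′ → PQ? α′ β) (λ α′ → P? α′ β)
              (λ _ q → q , C-far (λ j n → ¬near j (y→x₁ p (x→y₁ q n)))) (λ _ → proj₁)))
          ... | hit j h = trans (#-cong (P? α) (PQ? α) (λ _ → proj₁) (λ _ q → q , C-hit j h q))
            (trans (PQ-bal α β p) (#-cong (λ α′ → PQ? α′ β) (λ α′ → P? α′ β)
              (λ _ q → q , C-hit j (y→x₀ q (x→y₀ p h)) q) (λ _ → proj₁)))
          -- Row and column are the shares of one free coset in two evenly spread sets. These sets
          -- have equal size by `PQ-bal`, and `π` matches the free points of `x` with those of `y`;
          -- their positive number cancels.
          ... | free j Fα@(near , ¬hit) = ℕ.*-cancelˡ-≡ _ _ (# (Free? x j)) {{>-nonZero (#-positive (Free? x j) α Fα)}} (begin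
            # (Free? x j) * # (P? α)                                       ≡⟨ cong₂ _*_ W≡W row ⟩
            # (Free? y j) * # (λ b → PQ? α b ×-dec ∼? U₀ β b)               ≡⟨ equidistributed y j (PQ? α) (x→yF Fα) invʳ β (x→yF Fα p) ⟩
            # (PQ? α) * # (∼? U₀ 𝟘)                                        ≡⟨ cong (_* # (∼? U₀ 𝟘)) (PQ-bal α β p) ⟩
            # (λ a → PQ? a β) * # (∼? U₀ 𝟘)                                ≡⟨ equidistributed x j (λ a → PQ? a β) (λ q → y→xF q (x→yF Fα p)) invˡ α Fα ⟨
            # (Free? x j) * # (λ a → PQ? a β ×-dec ∼? U₀ α a)               ≡⟨ cong (# (Free? x j) *_) col ⟩
            # (Free? x j) * # (λ a → P? a β) ∎)
            where
            open ≡-Reasoning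
            x→yF : ∀ {γ δ} → Free x j γ → PQ γ δ → Free y j δ
            x→yF (n , ¬h) q = x→y₁ q n , λ i r → ¬h i (y→x₀ q r)
            y→xF : ∀ {γ δ} → PQ γ δ → Free y j δ → Free x j γ
            y→xF q (n , ¬h) = y→x₁ q n , λ i r → ¬h i (x→y₀ q r)
            W≡W : # (Free? x j) ≡ # (Free? y j)
            W≡W = #-bijection (Free? x j) (Free? y j) π (λ γ F → x→yF F (PQ-π γ)) (λ γ F → y→xF (PQ-π γ) F)
            row : # (P? α) ≡ # (λ b → PQ? α b ×-dec ∼? U₀ β b)
            row = #-cong (P? α) (λ b → PQ? α b ×-dec ∼? U₀ β b)
              (λ b (q , cb) → q , ∥→∼ U₀ (∥-trans U₀ (∥-sym U₀ (cαβ j near)) (cb j near)) (∼-refl U₀))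
              (λ b (q , β∼b) → q , C-base j (∥-trans U₀ (cαβ j near) (∼→∥ U₀ (∼-refl U₀) β∼b)) near)
            col : # (λ a → PQ? a β ×-dec ∼? U₀ α a) ≡ # (λ a → P? a β)
            col = #-cong (λ a → PQ? a β ×-dec ∼? U₀ α a) (λ a → P? a β)
              (λ a (q , α∼a) → q , C-base j (∥-trans U₀ (∼→∥ U₀ (∼-refl U₀) (s₀ α∼a)) (cαβ j near)) (t₁ near (0→1 α∼a)))
              (λ a (q , ca) → q , ∥→∼ U₀ (∥-trans U₀ (cαβ j near) (∥-sym U₀ (ca j (y→x₁ q (x→y₁ p near))))) (∼-refl U₀))
            invʳ : ∀ (f : Automorphism X) → (∀ i → Inverse.to (bij f) (y i) ≡ y i) → ∀ {b} → PQ α b → PQ α (Inverse.to (bij f) b)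
            invʳ f fix {b} q i = autʳ f (upd-map (Inverse.to (bij f)) (λ l → sym (fix l)) i b) (q i)
            invˡ : ∀ (f : Automorphism X) → (∀ i → Inverse.to (bij f) (x i) ≡ x i) → ∀ {a} → PQ a β → PQ (Inverse.to (bij f) a) β
            invˡ f fix {a} q i = autˡ f (upd-map (Inverse.to (bij f)) (λ l → sym (fix l)) i a) (q i)

        compatible-move : Σ (Fin N ↔ Fin N) λ π → ∀ α i → Q (upd x i α) (upd y i (Inverse.to π α)) ×
          Compatible U₁ U₀ (upd x i α) (upd y i (Inverse.to π α))
        compatible-move = let π , h = balanced→perfect (tot , bal) in π , λ α i → proj₁ (h α) i , compat α _ (proj₂ (h α)) i
          where
          compat : ∀ α β → C α β → ∀ i → Compatible U₁ U₀ (upd x i α) (upd y i β)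
          compat α β cαβ i j l with i ≟ j | i ≟ l
          ... | yes _ | yes _ = λ _ → ∥-diagonal U₀
          ... | yes _ | no _  = λ p → ∥-flip U₀ (cαβ l (s₁ p))
          ... | no _  | yes _ = λ p → cαβ j p
          ... | no _  | no _  = comp j l

-- Regular and trivial sections

module _ {k : ℕ} where

  private
    N : ℕ
    N = suc k

  module _ (Y : Scheme {k}) where

    c-translate : ∀ {α β γ δ} → diff α β ≡ diff γ δ → c Y α β ≡ c Y γ δ
    c-translate {α} {β} {γ} {δ} e = trans (from𝟘 α β) (trans (cong (c Y 𝟘) e) (sym (from𝟘 γ δ)))
      where
      from𝟘 : ∀ α β → c Y α β ≡ c Y 𝟘 (diff α β)
      from𝟘 α β = trans (sym (cong₂ (c Y) (⊕-identityˡ α) (trans (⊕-comm (diff α β) α) (⊕-diff α β)))) (circulant Y 𝟘 (diff α β) α)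

    c-diagonal : ∀ α β → c Y α α ≡ c Y β β
    c-diagonal α β = c-translate (trans (diff-self α) (sym (diff-self β)))

    isect-# : ∀ α β s₁ s₂ → isect (c Y) α β s₁ s₂ ≡ # (λ γ → (c Y α γ ≟ s₁) ×-dec (c Y γ β ≟ s₂))
    isect-# α β s₁ s₂ = length-filter (λ γ → (c Y α γ ≟ s₁) ×-dec (c Y γ β ≟ s₂))

    -- An intersection number that is positive at one pair of a basis relation is positive at all of
    -- them; this transports an intermediate point.
    between : ∀ {α β γ δ} → c Y α β ≡ c Y γ δ → ∀ ξ → ∃[ η ] (c Y γ η ≡ c Y α ξ × c Y η δ ≡ c Y ξ β)
    between {α} {β} {γ} {δ} e ξ = #-witness (λ η → (c Y γ η ≟ c Y α ξ) ×-dec (c Y η δ ≟ c Y ξ β))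
      (subst (0 <_) (trans (sym (isect-# α β _ _)) (trans (coherent Y α β γ δ e (c Y α ξ) (c Y ξ β)) (isect-# γ δ _ _)))
        (#-positive (λ η → (c Y α η ≟ c Y α ξ) ×-dec (c Y η β ≟ c Y ξ β)) ξ (refl , refl)))

    group-∼ : ∀ H → IsXGroup Y H → ∀ {α β γ δ} → c Y α β ≡ c Y γ δ → α ∼[ H ] β → γ ∼[ H ] δ
    group-∼ H g e (mk∼ p) = mk∼ (trans (sym (g _ _ _ _ e)) p)

    -- The uniqueness half of `RegularOn`, freed by translation from the restriction to pairs inside
    -- `U`. Translations also supply the existence half.
    Regular : Subgroup → Subgroup → Set
    Regular U L = ∀ {α β γ δ} → c Y α β ≡ c Y γ δ → α ∼[ U ] β → Par L α β γ δ

    RegularOn→Regular : ∀ {U L} → IsXGroup Y U → RegularOn Y U L → Regular U L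
    RegularOn→Regular {U} {L} U-Y reg {α} {β} {γ} {δ} e (mk∼ p) =
      mk∥ (proj₂ (reg s (𝟘 , diff α β , has𝟘 U , p , col α β refl) 𝟘 (has𝟘 U)) (diff α β) (diff γ δ) p
        (∼-mem (group-∼ U U-Y e (mk∼ p))) (qrel α β refl) (qrel γ δ (sym e)))
      where
      s : Fin (r Y)
      s = c Y α β
      col : ∀ γ δ → c Y γ δ ≡ s → c Y 𝟘 (diff γ δ) ≡ s
      col γ δ e′ = trans (c-translate (diff-𝟘 (diff γ δ))) e′
      qrel : ∀ γ δ → c Y γ δ ≡ s → QRel Y L s 𝟘 (diff γ δ)
      qrel γ δ e′ = 𝟘 , diff γ δ , ∼-mem (∼-refl L {𝟘}) , ∼-mem (∼-refl L {diff γ δ}) , col γ δ e′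

    Regular→RegularOn : ∀ {U L} → IsXGroup Y U → Regular U L → RegularOn Y U L
    Regular→RegularOn {U} {L} U-Y reg s (α₀ , β₀ , α₀∈U , β₀∈U , refl) α α∈U =
      (α ⊕ diff α₀ β₀ , closed⊕ U _ _ α∈U Δ∈U , α , α ⊕ diff α₀ β₀ , ∼-mem (∼-refl L {α}) , ∼-mem (∼-refl L {α ⊕ diff α₀ β₀}) ,
        c-translate (diff-⊕ α (diff α₀ β₀))) ,
      λ β β′ _ _ (α₁ , β₁ , α∼α₁ , β∼β₁ , e₁) (α₂ , β₂ , α∼α₂ , β∼β₂ , e₂) → ∼-mem (∥→∼ L
        (∥-trans L (∼→∥ L (mk∼ {a = α} {b = α₁} α∼α₁) (mk∼ {a = β} {b = β₁} β∼β₁)) (∥-trans L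
          (∥-trans L (∥-sym L (reg (sym e₁) (mk∼ Δ∈U))) (reg (sym e₂) (mk∼ Δ∈U)))
          (∼→∥ L (∼-sym L (mk∼ {a = α} {b = α₂} α∼α₂)) (∼-sym L (mk∼ {a = β′} {b = β₂} β∼β₂))))) (∼-refl L))
      where
      Δ∈U : diff α₀ β₀ ∈ᴴ U
      Δ∈U = closed⊕ U _ _ β₀∈U (closed⊖ U _ α₀∈U)

    -- Triviality seen from `𝟘`, in a form that passes between projectively equivalent sections: the
    -- colour of any nontrivial point reaches every nontrivial coset of `L` in `U`.
    Homogeneous : Subgroup → Subgroup → Set
    Homogeneous U L = ∀ {a b} → a ∈ᴴ U → ¬ a ∈ᴴ L → b ∈ᴴ U → ¬ b ∈ᴴ L → ∃[ b′ ] (b ∼[ L ] b′ × c Y 𝟘 b′ ≡ c Y 𝟘 a)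

  Homogeneous-of-Trivial : ∀ X (S : Section {k} X) → Trivial X S → Homogeneous X (U S) (L S)
  Homogeneous-of-Trivial X S triv {a} {b} a∈ a∉ b∈ b∉ with triv (c X 𝟘 a) (𝟘 , a , has𝟘 (U S) , a∈ , refl)
  ... | inj₁ diag = ⊥-elim (a∉ (∈-≡ (L S) (sym (diff-𝟘 a)) (Equivalence.to (diag 𝟘 a (has𝟘 (U S)) a∈)
          (𝟘 , a , ∼-mem (∼-refl (L S) {𝟘}) , ∼-mem (∼-refl (L S) {a}) , refl))))
  ... | inj₂ off with Equivalence.from (off 𝟘 b (has𝟘 (U S)) b∈) (λ p → b∉ (∈-≡ (L S) (sym (diff-𝟘 b)) p))
  ...   | α₀ , β₀ , 0∼α₀ , b∼β₀ , e = diff α₀ β₀ ,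
          ∥→∼ (L S) (mk∥ {a = 𝟘} {b = b} {c = 𝟘} {d = diff α₀ β₀} (∈-≡ (L S) eq (∥-mem par))) (∼-refl (L S)) ,
          trans (c-translate X (diff-𝟘 (diff α₀ β₀))) e
    where
    par : Par (L S) 𝟘 b α₀ β₀
    par = ∼→∥ (L S) (mk∼ 0∼α₀) (mk∼ b∼β₀)
    eq : diff (diff 𝟘 b) (diff 𝟘 (diff α₀ β₀)) ≡ diff (diff 𝟘 b) (diff α₀ β₀)
    eq = cong (diff (diff 𝟘 b)) (diff-𝟘 (diff α₀ β₀))

  group-≤ : ∀ X Y H → X ≤ˢ Y → IsXGroup {k} X H → IsXGroup Y H
  group-≤ X Y H X≤Y g α β γ δ e = g α β γ δ (X≤Y α β γ δ e)

  ∈→∼ : ∀ (H : Subgroup {k}) {a} → a ∈ᴴ H → 𝟘 ∼[ H ] a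
  ∈→∼ H {a} p = mk∼ (∈-≡ H (diff-𝟘 a) p)

  ∼⊕ : ∀ (H : Subgroup {k}) {a b} → b ∈ᴴ H → a ∼[ H ] (a ⊕ b)
  ∼⊕ H {a} {b} p = mk∼ (∈-≡ H (diff-⊕ a b) p)

  -- Transport along projective equivalence.

  module _ (X Y : Scheme {k}) (X≤Y : X ≤ˢ Y) where

    module _ (S T : Section X) (mult : MultipleOf S T) where

      private
        US LS UT LT : Subgroup
        US = U S
        LS = L S
        UT = U T
        LT = L T

        LS-Y : IsXGroup Y LS
        LS-Y = group-≤ X Y LS X≤Y (L-X S)

        UT-Y : IsXGroup Y UT
        UT-Y = group-≤ X Y UT X≤Y (U-X T)

        meet : IsMeet LT UT LS
        meet = proj₁ mult

        prod : IsProd US UT LS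
        prod = proj₂ mult

        UT⊆US : UT ⊆ᴴ US
        UT⊆US g p = Equivalence.from (prod g) (g , 𝟘 , p , has𝟘 LS , sym (⊕-identityʳ g))

        LT⊆LS : LT ⊆ᴴ LS
        LT⊆LS g p = proj₂ (Equivalence.to (meet g) p)

      regular-down : Regular Y US LS → Regular Y UT LT
      regular-down reg {α} {β} {γ} {δ} e (mk∼ p) = mk∥ (Equivalence.from (meet (diff (diff α β) (diff γ δ)))
        (closed⊕ UT _ _ (∼-mem (group-∼ Y UT UT-Y {α} {β} {γ} {δ} e (mk∼ p))) (closed⊖ UT _ p) , ∥-mem (reg e (mk∼ (UT⊆US _ p)))))

      regular-up : Regular Y UT LT → Regular Y US LS
      regular-up reg {α} {β} {γ} {δ} e (mk∼ p) with Equivalence.to (prod (diff α β)) p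
      ... | a , b , a∈ , b∈ , Δ≡ with between Y e (α ⊕ a)
      -- The difference is split at `α ⊕ a`. The first leg lies in `UT`, where regularity is given;
      -- the second stays inside a coset of `LS` for both pairs.
      ...   | η , e₁ , e₂ = ∥-chain LS
              (let mk∥ q = reg (sym e₁) (∼⊕ UT a∈) in mk∥ {a = α} {b = α ⊕ a} {c = γ} {d = η} (LT⊆LS _ q))
              (∼→∥-zero αa∼β (group-∼ Y LS LS-Y (sym e₂) αa∼β))
        where
        αa∼β : (α ⊕ a) ∼[ LS ] β
        αa∼β = mk∼ (∈-≡ LS (trans (trans (diff-chain (α ⊕ a) α β) (cong (diff (α ⊕ a) α ⊕_) Δ≡))
          (linear (α ∷ a ∷ b ∷ []) (:diff (v0 :⊕ v1) v0 :⊕ (v1 :⊕ v2)) v2 refl)) b∈)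
        ∼→∥-zero : ∀ {u v u′ v′} → u ∼[ LS ] v → u′ ∼[ LS ] v′ → Par LS u v u′ v′
        ∼→∥-zero p q = ∥-trans LS (∼→∥ LS (∼-refl LS) (∼-sym LS p)) (∥-trans LS (∥-diagonal LS) (∼→∥ LS (∼-refl LS) q))

      homogeneous-down : Homogeneous Y US LS → Homogeneous Y UT LT
      homogeneous-down hom {a} {b} a∈ a∉ b∈ b∉ =
        let b′ , mk∼ q , e = hom (UT⊆US _ a∈) (λ p → a∉ (Equivalence.from (meet a) (a∈ , p))) (UT⊆US _ b∈) (λ p → b∉ (Equivalence.from (meet b) (b∈ , p))) in
        b′ , mk∼ (Equivalence.from (meet (diff b b′)) (∼-mem (∼-trans UT (∼-sym UT (∈→∼ UT b∈)) (group-∼ Y UT UT-Y (sym e) (∈→∼ UT a∈))) , q)) , e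

      homogeneous-up : Homogeneous Y UT LT → Homogeneous Y US LS
      homogeneous-up hom {a} {b} a∈ a∉ b∈ b∉ with Equivalence.to (prod a) a∈ | Equivalence.to (prod b) b∈
      ... | a₁ , a₂ , a₁∈ , a₂∈ , refl | b₁ , b₂ , b₁∈ , b₂∈ , refl
        with hom a₁∈ (λ p → a∉ (closed⊕ LS _ _ (LT⊆LS _ p) a₂∈)) b₁∈ (λ p → b∉ (closed⊕ LS _ _ (LT⊆LS _ p) b₂∈))
      ...   | b₁′ , mk∼ b₁∼ , e with between Y (sym e) (a₁ ⊕ a₂)
      -- `η` has the required colour from `𝟘`, and its colour to `b₁′` is that of `a₁ ⊕ a₂` to `a₁`,
      -- which keeps it in the `LS`-coset of `b₁`.
      ...     | η , e₁ , e₂ = η , ∼-trans LS (∼-sym LS (∼⊕ LS b₂∈)) (∼-trans LS (mk∼ {a = b₁} {b = b₁′} (LT⊆LS _ b₁∼))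
                (∼-sym LS (group-∼ Y LS LS-Y (sym e₂) (∼-sym LS (∼⊕ LS a₂∈))))) , e₁

  ProjEq-invariant : ∀ {X : Scheme {k}} (P : Section X → Set) → (∀ S T → MultipleOf S T → P S ⇔ P T) →
    ∀ {S T} → ProjEq S T → P S ⇔ P T
  ProjEq-invariant P inv pe-refl = ⇔-id _
  ProjEq-invariant P inv (pe-mult h) = inv _ _ h
  ProjEq-invariant P inv (pe-sym p) = ⇔-sym (ProjEq-invariant P inv p)
  ProjEq-invariant P inv (pe-trans p q) = ProjEq-invariant P inv q ⇔-∘ ProjEq-invariant P inv p

  regular-ProjEq : ∀ X Y → X ≤ˢ Y → ∀ {S T : Section {k} X} → ProjEq S T → Regular Y (U S) (L S) ⇔ Regular Y (U T) (L T)
  regular-ProjEq X Y X≤Y = ProjEq-invariant (λ S → Regular Y (U S) (L S))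
    (λ S T h → mk⇔ (regular-down X Y X≤Y S T h) (regular-up X Y X≤Y S T h))

  homogeneous-ProjEq : ∀ X {S T : Section {k} X} → ProjEq S T → Homogeneous X (U S) (L S) ⇔ Homogeneous X (U T) (L T)
  homogeneous-ProjEq X = ProjEq-invariant (λ S → Homogeneous X (U S) (L S))
    (λ S T h → mk⇔ (homogeneous-down X X (λ _ _ _ _ → id) S T h) (homogeneous-up X X (λ _ _ _ _ → id) S T h))

-- Swapping two U₀-cosets

module _ {k : ℕ} where

  private
    N : ℕ
    N = suc k

  -- Outside e(U) a basis relation absorbs `L` on both sides, so the two end points can be moved one
  -- after the other.
  condition-invariant : ∀ (X : Scheme {k}) U L → IsXGroup X U → Condition X U L →
    ∀ {α β α′ β′} → ¬ α ∼[ U ] β → α ∼[ L ] α′ → β ∼[ L ] β′ → c X α′ β′ ≡ c X α β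
  condition-invariant X U L U-X cond {α} {β} {α′} {β′} ¬αβ αα′ ββ′ =
    Equivalence.to (proj₂ (cond s outside) α′ β′)
      (β , Equivalence.to (proj₁ (cond s outside) α′ β) (α , ∼-mem (∼-sym L αα′) , refl) , ∼-mem ββ′)
    where
    s : Fin (r X)
    s = c X α β
    outside : ∀ γ δ → c X γ δ ≡ s → ¬ diff γ δ ∈ᴴ U
    outside γ δ e p = ¬αβ (group-∼ X U U-X e (mk∼ p))

  module Swaps (X : Scheme {k}) (U₁ L₁ U₀ L₀ : Subgroup {k}) (U₁-X : IsXGroup X U₁) (U₀-X : IsXGroup X U₀)
    (meet : IsMeet L₀ L₁ U₀) (prod : IsProd U₁ L₁ U₀) (cond₀ : Condition X U₀ L₀) (cond₁ : Condition X U₁ L₁)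
    (tensor : TensorCond X U₁ L₁ U₀ L₀) (hom : Homogeneous X L₁ L₀) where

    private
      0∈L₁ : 𝟘 ∈ᴴ L₁
      0∈L₁ = has𝟘 L₁
      0∈U₀ : 𝟘 ∈ᴴ U₀
      0∈U₀ = has𝟘 U₀
      L₀⊆U₀ : L₀ ⊆ᴴ U₀
      L₀⊆U₀ g p = proj₂ (Equivalence.to (meet g) p)

    -- Inside U₁ ∖ U₀ the colour depends on the U₀/L₀-component of the difference only, since the
    -- L₁/L₀-component runs through a single nontrivial basis relation.
    colour-mod-L₁ : ∀ {α β β′} → α ∼[ U₁ ] β → ¬ α ∼[ U₀ ] β → ¬ α ∼[ U₀ ] β′ → β ∼[ L₁ ] β′ → c X α β′ ≡ c X α β
    colour-mod-L₁ {α} {β} {β′} (mk∼ αβ) ¬αβ ¬αβ′ (mk∼ l∈) with Equivalence.to (prod (diff α β)) αβ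
    ... | a , u , a∈ , u∈ , Δ≡ = begin
      c X α β′                    ≡⟨ c-translate X (trans Δ′≡ (sym (start ((a ⊕ l) ⊕ u)))) ⟩
      c X (𝟘 ⊕ 𝟘) ((a ⊕ l) ⊕ u)   ≡⟨ inv ¬Δ′ α₁∼ β₁∼ ⟨
      c X α₁ β₁                   ≡⟨ trans e₁ (sym e₀) ⟩
      c X α₀ β₀                   ≡⟨ inv ¬Δ α₀∼ β₀∼ ⟩
      c X (𝟘 ⊕ 𝟘) (a ⊕ u)         ≡⟨ c-translate X (trans (start (a ⊕ u)) (sym Δ≡)) ⟩
      c X α β ∎
      where
      open ≡-Reasoning
      l : Fin N
      l = diff β β′
      -- `TensorCond` speaks of sums of components, hence the base point in the form `𝟘 ⊕ 𝟘`.
      start : ∀ g → diff (𝟘 ⊕ 𝟘) g ≡ g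
      start g = linear (g ∷ []) (:diff (:𝟘 :⊕ :𝟘) v0) v0 refl
      Δ′≡ : diff α β′ ≡ (a ⊕ l) ⊕ u
      Δ′≡ = trans (trans (diff-chain α β β′) (cong (_⊕ l) Δ≡)) (linear (a ∷ u ∷ l ∷ []) ((v0 :⊕ v1) :⊕ v2) ((v0 :⊕ v2) :⊕ v1) refl)
      inv : ∀ {γ δ γ′ δ′} → ¬ γ ∼[ U₀ ] δ → γ ∼[ L₀ ] γ′ → δ ∼[ L₀ ] δ′ → c X γ′ δ′ ≡ c X γ δ
      inv = condition-invariant X U₀ L₀ U₀-X cond₀
      ¬Δ : ¬ (𝟘 ⊕ 𝟘) ∼[ U₀ ] (a ⊕ u)
      ¬Δ (mk∼ p) = ¬αβ (mk∼ (∈-≡ U₀ (trans Δ≡ (sym (start (a ⊕ u)))) p))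
      ¬Δ′ : ¬ (𝟘 ⊕ 𝟘) ∼[ U₀ ] ((a ⊕ l) ⊕ u)
      ¬Δ′ (mk∼ p) = ¬αβ′ (mk∼ (∈-≡ U₀ (trans Δ′≡ (sym (start ((a ⊕ l) ⊕ u)))) p))
      a∉ : ¬ a ∈ᴴ L₀
      a∉ p = ¬αβ (mk∼ (∈-≡ U₀ Δ≡ (closed⊕ U₀ _ _ (L₀⊆U₀ _ p) u∈)))
      al∉ : ¬ (a ⊕ l) ∈ᴴ L₀
      al∉ p = ¬αβ′ (mk∼ (∈-≡ U₀ Δ′≡ (closed⊕ U₀ _ _ (L₀⊆U₀ _ p) u∈)))
      al∈ : (a ⊕ l) ∈ᴴ L₁
      al∈ = closed⊕ L₁ _ _ a∈ l∈
      r₀ : ∀ g → diff g g ∈ᴴ L₀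
      r₀ g = ∼-mem (∼-refl L₀ {g})
      same₁ : QSame X L₀ 𝟘 a 𝟘 (a ⊕ l)
      same₁ = let b′ , al∼b′ , e = hom a∈ a∉ al∈ al∉ in
        c X 𝟘 a , (𝟘 , a , r₀ 𝟘 , r₀ a , refl) , (𝟘 , b′ , r₀ 𝟘 , ∼-mem al∼b′ , e)
      same₂ : QSame X L₀ 𝟘 u 𝟘 u
      same₂ = c X 𝟘 u , (𝟘 , u , r₀ 𝟘 , r₀ u , refl) , (𝟘 , u , r₀ 𝟘 , r₀ u , refl)
      -- The tensor condition yields equal colours only for representatives modulo `L₀`. Both
      -- differences avoid `U₀`, so `inv` returns from the representatives to the points.
      same : QSame X L₀ (𝟘 ⊕ 𝟘) (a ⊕ u) (𝟘 ⊕ 𝟘) ((a ⊕ l) ⊕ u)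
      same = Equivalence.from (tensor 𝟘 𝟘 a u 𝟘 𝟘 (a ⊕ l) u 0∈L₁ a∈ 0∈L₁ al∈ 0∈U₀ u∈ 0∈U₀ u∈) (same₁ , same₂)
      q₀ : QRel X L₀ (proj₁ same) (𝟘 ⊕ 𝟘) (a ⊕ u)
      q₀ = proj₁ (proj₂ same)
      q₁ : QRel X L₀ (proj₁ same) (𝟘 ⊕ 𝟘) ((a ⊕ l) ⊕ u)
      q₁ = proj₂ (proj₂ same)
      α₀ β₀ α₁ β₁ : Fin N
      α₀ = proj₁ q₀
      β₀ = proj₁ (proj₂ q₀)
      α₁ = proj₁ q₁
      β₁ = proj₁ (proj₂ q₁)
      α₀∼ : (𝟘 ⊕ 𝟘) ∼[ L₀ ] α₀
      α₀∼ = mk∼ (proj₁ (proj₂ (proj₂ q₀)))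
      β₀∼ : (a ⊕ u) ∼[ L₀ ] β₀
      β₀∼ = mk∼ (proj₁ (proj₂ (proj₂ (proj₂ q₀))))
      e₀ : c X α₀ β₀ ≡ proj₁ same
      e₀ = proj₂ (proj₂ (proj₂ (proj₂ q₀)))
      α₁∼ : (𝟘 ⊕ 𝟘) ∼[ L₀ ] α₁
      α₁∼ = mk∼ (proj₁ (proj₂ (proj₂ q₁)))
      β₁∼ : ((a ⊕ l) ⊕ u) ∼[ L₀ ] β₁
      β₁∼ = mk∼ (proj₁ (proj₂ (proj₂ (proj₂ q₁))))
      e₁ : c X α₁ β₁ ≡ proj₁ same
      e₁ = proj₂ (proj₂ (proj₂ (proj₂ q₁)))

    module _ (a b : Fin N) (l : Fin N) (l∈ : l ∈ᴴ L₁) (al∼b : (a ⊕ l) ∼[ U₀ ] b) (a≁b : ¬ a ∼[ U₀ ] b) where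

      private
        s₀ : ∀ {a b} → a ∼[ U₀ ] b → b ∼[ U₀ ] a
        s₀ = ∼-sym U₀
        t₀ : ∀ {a b c} → a ∼[ U₀ ] b → b ∼[ U₀ ] c → a ∼[ U₀ ] c
        t₀ = ∼-trans U₀

        ⊕-congʳ : ∀ {γ δ} g → γ ∼[ U₀ ] δ → (γ ⊕ g) ∼[ U₀ ] (δ ⊕ g)
        ⊕-congʳ {γ} {δ} g (mk∼ p) = mk∼ (∈-≡ U₀ (diff-shift γ δ g) p)

        ⊕⊖ : ∀ g → (g ⊕ l) ⊕ (⊖ l) ≡ g
        ⊕⊖ g = linear (g ∷ l ∷ []) ((v0 :⊕ v1) :⊕ (:⊖ v1)) v0 refl

        data Place (γ : Fin N) : Set where
          in-a : a ∼[ U₀ ] γ → Place γ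
          in-b : b ∼[ U₀ ] γ → Place γ
          out  : ¬ a ∼[ U₀ ] γ → ¬ b ∼[ U₀ ] γ → Place γ

        place : ∀ γ → Place γ
        place γ with ∼? U₀ a γ | ∼? U₀ b γ
        ... | yes p | _ = in-a p
        ... | no _ | yes q = in-b q
        ... | no ¬p | no ¬q = out ¬p ¬q

        shift : ∀ {γ} → Place γ → Fin N
        shift (in-a _) = l
        shift (in-b _) = ⊖ l
        shift (out _ _) = 𝟘

        -- The shift depends on the `U₀`-coset alone, so `f` can be evaluated with any proof that
        -- locates the point.
        shift-cong : ∀ {γ δ} (p : Place γ) (q : Place δ) → γ ∼[ U₀ ] δ → shift p ≡ shift q
        shift-cong (in-a _) (in-a _) e = refl
        shift-cong (in-a p) (in-b q) e = ⊥-elim (a≁b (t₀ p (t₀ e (s₀ q))))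
        shift-cong (in-a p) (out ¬p _) e = ⊥-elim (¬p (t₀ p e))
        shift-cong (in-b p) (in-a q) e = ⊥-elim (a≁b (t₀ q (t₀ (s₀ e) (s₀ p))))
        shift-cong (in-b _) (in-b _) e = refl
        shift-cong (in-b p) (out _ ¬p) e = ⊥-elim (¬p (t₀ p e))
        shift-cong (out ¬p _) (in-a q) e = ⊥-elim (¬p (t₀ q (s₀ e)))
        shift-cong (out _ ¬p) (in-b q) e = ⊥-elim (¬p (t₀ q (s₀ e)))
        shift-cong (out _ _) (out _ _) e = refl

        shift-∈ : ∀ {γ} (p : Place γ) → shift p ∈ᴴ L₁
        shift-∈ (in-a _) = l∈
        shift-∈ (in-b _) = closed⊖ L₁ _ l∈
        shift-∈ (out _ _) = has𝟘 L₁

        f : Fin N → Fin N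
        f γ = γ ⊕ shift (place γ)

        f-at : ∀ {γ} (p : Place γ) → f γ ≡ γ ⊕ shift p
        f-at {γ} p = cong (γ ⊕_) (shift-cong (place γ) p (∼-refl U₀))

        a→b′ : ∀ {γ} → a ∼[ U₀ ] γ → b ∼[ U₀ ] (γ ⊕ l)
        a→b′ p = t₀ (s₀ al∼b) (⊕-congʳ l p)

        b→a′ : ∀ {γ} → b ∼[ U₀ ] γ → a ∼[ U₀ ] (γ ⊕ (⊖ l))
        b→a′ {γ} p = subst (_∼[ U₀ ] (γ ⊕ (⊖ l))) (⊕⊖ a) (⊕-congʳ (⊖ l) (t₀ al∼b p))

        f-involutive : ∀ γ → f (f γ) ≡ γ
        f-involutive γ with place γ
        ... | in-a p = trans (f-at (in-b (a→b′ p))) (⊕⊖ γ)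
        ... | in-b p = trans (f-at (in-a (b→a′ p))) (linear (γ ∷ l ∷ []) ((v0 :⊕ (:⊖ v1)) :⊕ v1) v0 refl)
        ... | out p q = trans (cong f (⊕-identityʳ γ)) (trans (f-at (out p q)) (⊕-identityʳ γ))

        f-∼ : ∀ {γ δ} → γ ∼[ U₀ ] δ → f γ ∼[ U₀ ] f δ
        f-∼ {γ} {δ} e = subst (λ g → f γ ∼[ U₀ ] (δ ⊕ g)) (shift-cong (place γ) (place δ) e) (⊕-congʳ (shift (place γ)) e)

        f-∼⁻¹ : ∀ {γ δ} → f γ ∼[ U₀ ] f δ → γ ∼[ U₀ ] δ
        f-∼⁻¹ {γ} {δ} e = subst₂ (_∼[ U₀ ]_) (f-involutive γ) (f-involutive δ) (f-∼ e)

        f-L₁ : ∀ γ → γ ∼[ L₁ ] f γ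
        f-L₁ γ = ∼⊕ L₁ (shift-∈ (place γ))

        -- Within a `U₀`-coset `f` is a translation, and outside `U₁` the condition absorbs the
        -- shifts. In between, undoing the shift of `α` on both points leaves a motion of `β` within
        -- its `L₁`-coset, which `colour-mod-L₁` covers.
        f-invariant : ∀ α β → c X (f α) (f β) ≡ c X α β
        f-invariant α β with ∼? U₀ α β | ∼? U₁ α β
        ... | yes αβ | _ = trans (cong (λ g → c X (f α) (β ⊕ g)) (shift-cong (place β) (place α) (s₀ αβ))) (circulant X α β (shift (place α)))
        ... | no _ | no ¬αβ = condition-invariant X U₁ L₁ U₁-X cond₁ ¬αβ (f-L₁ α) (f-L₁ β)
        ... | no ¬αβ₀ | yes αβ₁ = trans (c-translate X diff≡) (colour-mod-L₁ αβ₁ ¬αβ₀ ¬αβ′ (∼-trans L₁ (f-L₁ β) (∼⊕ L₁ (closed⊖ L₁ _ (shift-∈ (place α))))))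
          where
          β′ : Fin N
          β′ = f β ⊕ (⊖ shift (place α))
          diff≡ : diff (f α) (f β) ≡ diff α β′
          diff≡ = linear (α ∷ shift (place α) ∷ f β ∷ []) (:diff (v0 :⊕ v1) v2) (:diff v0 (v2 :⊕ (:⊖ v1))) refl
          ¬αβ′ : ¬ α ∼[ U₀ ] β′
          ¬αβ′ (mk∼ p) = ¬αβ₀ (f-∼⁻¹ (mk∼ (∈-≡ U₀ diff≡ p)))

      proper-swap : Swap X U₀ a b
      proper-swap = record
        { aut        = automorphism (mk↔ₛ′ f f f-involutive f-involutive) f-invariant
        ; involutive = f-involutive
        ; a→b        = λ p → subst (b ∼[ U₀ ]_) (sym (f-at (in-a p))) (a→b′ p)
        ; b→a        = λ p → subst (a ∼[ U₀ ]_) (sym (f-at (in-b p))) (b→a′ p)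
        ; fixed      = λ {γ} p q → trans (f-at (out p q)) (⊕-identityʳ γ)
        }

    swap : ∀ a b → a ∼[ U₁ ] b → Swap X U₀ a b
    swap a b (mk∼ ab) with ∼? U₀ a b
    ... | yes a∼b = record
      { aut        = identity
      ; involutive = λ _ → refl
      ; a→b        = ∼-trans U₀ (∼-sym U₀ a∼b)
      ; b→a        = ∼-trans U₀ a∼b
      ; fixed      = λ _ _ → refl
      }
    ... | no a≁b with Equivalence.to (prod (diff a b)) ab
    -- The `L₁`-component `l` of the difference carries the `U₀`-coset of `a` to that of `b`.
    ...   | l , u , l∈ , u∈ , Δ≡ = proper-swap a b l l∈ (mk∼ (∈-≡ U₀ eq u∈)) a≁b
      where
      eq : diff (a ⊕ l) b ≡ u
      eq = trans (trans (diff-chain (a ⊕ l) a b) (cong (diff (a ⊕ l) a ⊕_) Δ≡))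
        (linear (a ∷ l ∷ u ∷ []) (:diff (v0 :⊕ v1) v0 :⊕ (v1 :⊕ v2)) v2 refl)

-- The extension

module _ {k : ℕ} where

  private
    N : ℕ
    N = suc k

  pair : ∀ {m} → Fin N → Fin N → Tup {k} (suc m)
  pair α β zero = α
  pair α β (suc _) = β

  SameColours : (X : Scheme {k}) → ∀ {m} → Tup {k} m → Tup {k} m → Set
  SameColours X x y = ∀ i j → c X (x i) (x j) ≡ c X (y i) (y j)

  pair-colours : ∀ X {m α β γ δ} → c X α β ≡ c X γ δ → SameColours X {suc m} (pair α β) (pair γ δ)
  pair-colours X e zero zero = c-diagonal X _ _
  pair-colours X e zero (suc j) = e
  pair-colours X e (suc i) zero = transpose X _ _ _ _ e
  pair-colours X e (suc i) (suc j) = c-diagonal X _ _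

  -- The number of answers to a point is an intersection number, equal on both sides by coherence.
  -- In this form coherence itself can be lifted.
  colour-game : ∀ X → Game X 2 (SameColours X)
  colour-game X = record
    { decide = λ x y → all? (λ i → all? (λ j → c X (x i) (x j) ≟ c X (y i) (y j)))
    ; difun  = λ p q r i j → trans (p i j) (trans (sym (q i j)) (r i j))
    ; autˡ   = λ f e p i j → trans (trans (cong₂ (c X) (e i) (e j)) (invariant f _ _)) (p i j)
    ; autʳ   = λ f e p i j → trans (p i j) (sym (trans (cong₂ (c X) (e i) (e j)) (invariant f _ _)))
    ; move   = move
    }
    where
    move : ∀ {x y : Tup {k} 2} → SameColours X x y → Σ (Fin N ↔ Fin N) λ π → ∀ α i → SameColours X (upd x i α) (upd y i (Inverse.to π α))
    move {x} {y} e = Matching.balanced→perfect P? P-difun (tot , bal)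
      where
      x₀ x₁ y₀ y₁ : Fin N
      x₀ = x zero
      x₁ = x (suc zero)
      y₀ = y zero
      y₁ = y (suc zero)
      P : Fin N → Fin N → Set
      P α β = ∀ i → SameColours X (upd x i α) (upd y i β)
      P? : ∀ α β → Dec (P α β)
      P? α β = all? (λ i → all? (λ j → all? (λ l → c X (upd x i α j) (upd x i α l) ≟ c X (upd y i β j) (upd y i β l))))
      P-difun : Difunctional P
      P-difun p q r i j l = trans (p i j l) (trans (sym (q i j l)) (r i j l))
      P-intro : ∀ {α β} → c X y₀ β ≡ c X x₀ α → c X β y₁ ≡ c X α x₁ → P α β
      P-intro e₀ e₁ zero zero zero = c-diagonal X _ _
      P-intro e₀ e₁ zero zero (suc zero) = sym e₁
      P-intro e₀ e₁ zero (suc zero) zero = transpose X _ _ _ _ (sym e₁)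
      P-intro e₀ e₁ zero (suc zero) (suc zero) = c-diagonal X _ _
      P-intro e₀ e₁ (suc zero) zero zero = c-diagonal X _ _
      P-intro e₀ e₁ (suc zero) zero (suc zero) = sym e₀
      P-intro e₀ e₁ (suc zero) (suc zero) zero = transpose X _ _ _ _ (sym e₀)
      P-intro e₀ e₁ (suc zero) (suc zero) (suc zero) = c-diagonal X _ _
      P-elim₀ : ∀ {α β} → P α β → c X y₀ β ≡ c X x₀ α
      P-elim₀ p = sym (p (suc zero) zero (suc zero))
      P-elim₁ : ∀ {α β} → P α β → c X β y₁ ≡ c X α x₁
      P-elim₁ p = sym (p zero zero (suc zero))
      tot : ∀ α → ∃[ β ] P α β
      tot α = let β , e₀ , e₁ = between X (e zero (suc zero)) α in β , P-intro e₀ e₁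
      bal : ∀ α β → P α β → # (P? α) ≡ # (λ α′ → P? α′ β)
      bal α β p = begin
        # (P? α)                                              ≡⟨ #-cong (P? α) rowᶜ? (λ _ q → P-elim₀ q , P-elim₁ q) (λ _ (e₀ , e₁) → P-intro e₀ e₁) ⟩
        # rowᶜ?                                               ≡⟨ isect-# X y₀ y₁ _ _ ⟨
        isect (c X) y₀ y₁ (c X x₀ α) (c X α x₁)               ≡⟨ coherent X _ _ _ _ (e zero (suc zero)) _ _ ⟨
        isect (c X) x₀ x₁ (c X x₀ α) (c X α x₁)               ≡⟨ isect-# X x₀ x₁ _ _ ⟩
        # colᶜ?                                               ≡⟨ #-cong colᶜ? (λ α′ → P? α′ β)
          (λ _ (e₀ , e₁) → P-intro (trans (P-elim₀ p) (sym e₀)) (trans (P-elim₁ p) (sym e₁)))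
          (λ _ q → trans (sym (P-elim₀ q)) (P-elim₀ p) , trans (sym (P-elim₁ q)) (P-elim₁ p)) ⟩
        # (λ α′ → P? α′ β) ∎
        where
        open ≡-Reasoning
        rowᶜ? : ∀ γ → Dec (c X y₀ γ ≡ c X x₀ α × c X γ y₁ ≡ c X α x₁)
        rowᶜ? γ = (c X y₀ γ ≟ c X x₀ α) ×-dec (c X γ y₁ ≟ c X α x₁)
        colᶜ? : ∀ γ → Dec (c X x₀ γ ≡ c X x₀ α × c X γ x₁ ≡ c X α x₁)
        colᶜ? γ = (c X x₀ γ ≟ c X x₀ α) ×-dec (c X γ x₁ ≟ c X α x₁)

  module Extension (X : Scheme {k}) (U₁ U₀ : Subgroup {k}) (U₁-X : IsXGroup X U₁) (U₀-X : IsXGroup X U₀) (U₀⊆U₁ : U₀ ⊆ᴴ U₁)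
    (swap : ∀ a b → a ∼[ U₁ ] b → Swap X U₀ a b) where

    open Lifting X U₁ U₀ U₀⊆U₁ swap

    Fine : (α β γ δ : Fin N) → Set
    Fine α β γ δ = c X α β ≡ c X γ δ × (α ∼[ U₁ ] β → Par U₀ α β γ δ)

    fine? : ∀ α β γ δ → Dec (Fine α β γ δ)
    fine? α β γ δ = (c X α β ≟ c X γ δ) ×-dec (∼? U₁ α β →-dec Par? U₀ α β γ δ)

    fine-refl : ∀ {α β} → Fine α β α β
    fine-refl = refl , λ _ → ∥-refl U₀

    fine-sym : ∀ {α β γ δ} → Fine α β γ δ → Fine γ δ α β
    fine-sym (e , p) = sym e , λ n → ∥-sym U₀ (p (group-∼ X U₁ U₁-X (sym e) n))

    fine-trans : ∀ {α β γ δ ε ζ} → Fine α β γ δ → Fine γ δ ε ζ → Fine α β ε ζ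
    fine-trans (e , p) (e′ , p′) = trans e e′ , λ n → ∥-trans U₀ (p n) (p′ (group-∼ X U₁ U₁-X e n))

    colours-groups : ∀ {m} {x y : Tup {k} m} → SameColours X x y → ∀ U → U ≡ U₀ ⊎ U ≡ U₁ → ∀ i j → (x i ∼[ U ] x j) ⇔ (y i ∼[ U ] y j)
    colours-groups e U (inj₁ refl) i j = mk⇔ (group-∼ X U₀ U₀-X (e i j)) (group-∼ X U₀ U₀-X (sym (e i j)))
    colours-groups e U (inj₂ refl) i j = mk⇔ (group-∼ X U₁ U₁-X (e i j)) (group-∼ X U₁ U₁-X (sym (e i j)))

    pair-compatible : ∀ {m α β γ δ} → Fine α β γ δ → Compatible U₁ U₀ {suc m} (pair α β) (pair γ δ)
    pair-compatible f zero zero _ = ∥-diagonal U₀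
    pair-compatible f zero (suc j) n = proj₂ f n
    pair-compatible f (suc i) zero n = ∥-flip U₀ (proj₂ f (∼-sym U₁ n))
    pair-compatible f (suc i) (suc j) _ = ∥-diagonal U₀

    private
      code : Fin N → Fin N → Fin (N * N)
      code = combine

      left right : Fin (N * N) → Fin N
      left p = proj₁ (remQuot {N} N p)
      right p = proj₂ (remQuot {N} N p)

      left-code : ∀ α β → left (code α β) ≡ α
      left-code α β = cong proj₁ (Fin.remQuot-combine {N} {N} α β)
      right-code : ∀ α β → right (code α β) ≡ β
      right-code α β = cong proj₂ (Fin.remQuot-combine {N} {N} α β)

      classes : ∃[ r ] Σ (Fin (N * N) → Fin r) λ f → (∀ s → ∃[ a ] f a ≡ s) ×
        (∀ a b → f a ≡ f b → Fine (left a) (right a) (left b) (right b)) ×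
        (∀ a b → Fine (left a) (right a) (left b) (right b) → f a ≡ f b)
      classes = quotient (N * N) {λ a b → Fine (left a) (right a) (left b) (right b)}
        (λ a b → fine? (left a) (right a) (left b) (right b)) fine-refl fine-sym fine-trans

      cᶻ : Fin N → Fin N → Fin (proj₁ classes)
      cᶻ α β = proj₁ (proj₂ classes) (code α β)

      cᶻ→fine : ∀ {α β γ δ} → cᶻ α β ≡ cᶻ γ δ → Fine α β γ δ
      cᶻ→fine {α} {β} {γ} {δ} e = decode (proj₁ (proj₂ (proj₂ (proj₂ classes))) (code α β) (code γ δ) e)
        where
        decode : Fine (left (code α β)) (right (code α β)) (left (code γ δ)) (right (code γ δ)) → Fine α β γ δ
        decode h = subst₂ (λ γ δ → Fine α β γ δ) (left-code γ δ) (right-code γ δ)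
          (subst₂ (λ α β → Fine α β (left (code γ δ)) (right (code γ δ))) (left-code α β) (right-code α β) h)

      fine→cᶻ : ∀ {α β γ δ} → Fine α β γ δ → cᶻ α β ≡ cᶻ γ δ
      fine→cᶻ {α} {β} {γ} {δ} h = proj₂ (proj₂ (proj₂ (proj₂ classes))) (code α β) (code γ δ)
        (subst₂ (λ γ δ → Fine (left (code α β)) (right (code α β)) γ δ) (sym (left-code γ δ)) (sym (right-code γ δ))
          (subst₂ (λ α β → Fine α β γ δ) (sym (left-code α β)) (sym (right-code α β)) h))

      cᶻ-onto : ∀ s → ∃[ α ] ∃[ β ] cᶻ α β ≡ s
      cᶻ-onto s = let p , e = proj₁ (proj₂ (proj₂ classes)) s in
        left p , right p , trans (cong (proj₁ (proj₂ classes)) (Fin.combine-remQuot {N} N p)) e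

      -- A compatible answer to an intermediate point preserves its fine colours to both ends, so
      -- the bijection matches the two sets counted.
      cᶻ-coherent : ∀ α β γ δ → cᶻ α β ≡ cᶻ γ δ → ∀ s₁ s₂ → isect cᶻ α β s₁ s₂ ≡ isect cᶻ γ δ s₁ s₂
      cᶻ-coherent α β γ δ e s₁ s₂ = begin
        isect cᶻ α β s₁ s₂                                     ≡⟨ length-filter (at α β) ⟩
        # (at α β)                                             ≡⟨ #-bijection (at α β) (at γ δ) π
          (λ ξ (p , q) → trans (sym (e₀ ξ)) p , trans (sym (e₁ ξ)) q) (λ ξ (p , q) → trans (e₀ ξ) p , trans (e₁ ξ) q) ⟩
        # (at γ δ)                                             ≡⟨ length-filter (at γ δ) ⟨
        isect cᶻ γ δ s₁ s₂ ∎
        where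
        open ≡-Reasoning
        at : ∀ α β ξ → Dec (cᶻ α ξ ≡ s₁ × cᶻ ξ β ≡ s₂)
        at α β ξ = (cᶻ α ξ ≟ s₁) ×-dec (cᶻ ξ β ≟ s₂)
        mv = compatible-move (colour-game X) (λ U U≡ e → colours-groups e U U≡)
          {pair α β} {pair γ δ} (pair-colours X (proj₁ (cᶻ→fine e))) (pair-compatible (cᶻ→fine e))
        π : Fin N ↔ Fin N
        π = proj₁ mv
        e₀ : ∀ ξ → cᶻ α ξ ≡ cᶻ γ (Inverse.to π ξ)
        e₀ ξ = let e , f = proj₂ mv ξ (suc zero) in fine→cᶻ (e zero (suc zero) , f zero (suc zero))
        e₁ : ∀ ξ → cᶻ ξ β ≡ cᶻ (Inverse.to π ξ) δ
        e₁ ξ = let e , f = proj₂ mv ξ zero in fine→cᶻ (e zero (suc zero) , f zero (suc zero))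

    fine-scheme : Scheme {k}
    fine-scheme = record
      { r = proj₁ classes
      ; c = cᶻ
      ; nonempty = cᶻ-onto
      ; diagonal = λ α β γ δ e → diagonal X α β γ δ (proj₁ (cᶻ→fine e))
      ; transpose = λ α β γ δ e → let f , p = cᶻ→fine e in
          fine→cᶻ (transpose X α β γ δ f , λ n → ∥-flip U₀ (p (∼-sym U₁ n)))
      ; coherent = cᶻ-coherent
      ; circulant = λ α β g → fine→cᶻ (circulant X α β g , λ _ → mk∥ (∈-≡ U₀ (linear (α ∷ β ∷ g ∷ [])
          (:diff (:diff (v0 :⊕ v2) (v1 :⊕ v2)) (:diff v0 v1)) :𝟘 refl) (has𝟘 U₀)))
      }

    X≤fine : X ≤ˢ fine-scheme
    X≤fine α β γ δ e = proj₁ (cᶻ→fine e)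

    fine-regular : Regular fine-scheme U₁ U₀
    fine-regular e = proj₂ (cᶻ→fine e)

    fine→colour : ∀ {α β γ δ} → Fine α β γ δ → c fine-scheme α β ≡ c fine-scheme γ δ
    fine→colour = fine→cᶻ

-- The image of an X-group under an algebraic automorphism

module _ {k : ℕ} where

  private
    N : ℕ
    N = suc k

  move-back : ∀ {m} {Q : Tup {k} m → Tup {k} m → Set} {x y} →
    Σ (Fin N ↔ Fin N) (λ π → ∀ α i → Q (upd x i α) (upd y i (Inverse.to π α))) → ∀ β → ∃[ α ] (∀ i → Q (upd x i α) (upd y i β))
  move-back {Q = Q} {x} {y} (π , step) β = Inverse.from π β , λ i →
    subst (λ β → Q (upd x i (Inverse.from π _)) (upd y i β)) (Inverse.strictlyInverseˡ π β) (step (Inverse.from π β) i)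

  module _ {X : Scheme {k}} {m′ : ℕ} {φ : AlgAut X} (W : WLSelfEquiv X m′ φ) (H : Subgroup {k}) (H-X : IsXGroup X H) where

    open WLSelfEquiv W

    private
      φ⁻¹ : Fin (r X) → Fin (r X)
      φ⁻¹ = Inverse.from (perm φ)

      -- The image of e(H) under `φ`, read at the base point `𝟘`. By `IsXGroup` the value does not
      -- depend on the representative chosen.
      mem′ : Fin N → Bool
      mem′ g = let α , β , _ = nonempty X (φ⁻¹ (c X 𝟘 g)) in mem H (diff α β)

      image : ∀ {α β γ δ} → c X γ δ ≡ app φ (c X α β) → mem′ (diff γ δ) ≡ mem H (diff α β)
      image {α} {β} {γ} {δ} e = H-X _ _ _ _ (begin
        c X (proj₁ w) (proj₁ (proj₂ w))   ≡⟨ proj₂ (proj₂ w) ⟩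
        φ⁻¹ (c X 𝟘 (diff γ δ))            ≡⟨ cong φ⁻¹ (trans (c-translate X (diff-𝟘 (diff γ δ))) e) ⟩
        φ⁻¹ (app φ (c X α β))             ≡⟨ Inverse.strictlyInverseʳ (perm φ) (c X α β) ⟩
        c X α β ∎)
        where
        open ≡-Reasoning
        w : ∃[ α′ ] ∃[ β′ ] c X α′ β′ ≡ φ⁻¹ (c X 𝟘 (diff γ δ))
        w = nonempty X (φ⁻¹ (c X 𝟘 (diff γ δ)))

      image-R : ∀ {x y} → R x y → ∀ i j → mem′ (diff (y i) (y j)) ≡ mem H (diff (x i) (x j))
      image-R p i j = image (coord-eq W p i j)

      module _ {y : Tup {k} (suc (suc m′))} where
        preimage : Tup {k} (suc (suc m′))
        preimage = proj₁ (onto y)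
        preimage-R : R preimage y
        preimage-R = proj₂ (onto y)

      image-𝟘 : mem′ 𝟘 ≡ true
      image-𝟘 = begin
        mem′ 𝟘                      ≡⟨ cong mem′ (diff-self 𝟘) ⟨
        mem′ (diff 𝟘 𝟘)             ≡⟨ image-R (preimage-R {λ _ → 𝟘}) zero (suc zero) ⟩
        mem H (diff x₀ x₁)          ≡⟨ cong (λ x → mem H (diff x x₁)) (R-const⁻¹ W (preimage-R {λ _ → 𝟘}) (λ _ _ → refl) zero (suc zero)) ⟩
        mem H (diff x₁ x₁)          ≡⟨ ∼-mem (∼-refl H {x₁}) ⟩
        true ∎
        where
        open ≡-Reasoning
        x₀ x₁ : Fin N
        x₀ = preimage {λ _ → 𝟘} zero
        x₁ = preimage {λ _ → 𝟘} (suc zero)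

      image-⊖ : ∀ a → mem′ a ≡ true → mem′ (⊖ a) ≡ true
      image-⊖ a p = begin
        mem′ (⊖ a)                  ≡⟨ cong mem′ (linear (a ∷ []) (:⊖ v0) (:diff v0 :𝟘) refl) ⟩
        mem′ (diff a 𝟘)             ≡⟨ image-R (preimage-R {pair 𝟘 a}) (suc zero) zero ⟩
        mem H (diff x₁ x₀)          ≡⟨ ∼-mem (∼-sym H {x₀} {x₁} (mk∼ (trans (sym (image-R (preimage-R {pair 𝟘 a}) zero (suc zero))) (trans (cong mem′ (diff-𝟘 a)) p)))) ⟩
        true ∎
        where
        open ≡-Reasoning
        x₀ x₁ : Fin N
        x₀ = preimage {pair 𝟘 a} zero
        x₁ = preimage {pair 𝟘 a} (suc zero)

      image-⊕ : ∀ a b → mem′ a ≡ true → mem′ b ≡ true → mem′ (a ⊕ b) ≡ true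
      image-⊕ a b p q = begin
        mem′ (a ⊕ b)                ≡⟨ cong mem′ (diff-𝟘 (a ⊕ b)) ⟨
        mem′ (diff 𝟘 (a ⊕ b))       ≡⟨ image-R (preimage-R {y}) zero (suc zero) ⟩
        mem H (diff x₀ x₁)          ≡⟨ ∼-mem (∼-trans H (mk∼ {a = x₀} {b = γ} x₀γ) (mk∼ {a = γ} {b = x₁} γx₁)) ⟩
        true ∎
        where
        open ≡-Reasoning
        y : Tup {k} (suc (suc m′))
        y = pair 𝟘 (a ⊕ b)
        x₀ x₁ : Fin N
        x₀ = preimage {y} zero
        x₁ = preimage {y} (suc zero)
        -- The middle vertex of the triangle `𝟘`, `a`, `a ⊕ b` is pulled back to a point `γ`, and
        -- closure is inherited from `H`.
        back : ∃[ γ ] (∀ i → R (upd (preimage {y}) i γ) (upd y i a))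
        back = move-back {Q = R} (Game.move (R-game W) (preimage-R {y})) a
        γ : Fin N
        γ = proj₁ back
        R-γ : ∀ i → R (upd (preimage {y}) i γ) (upd y i a)
        R-γ = proj₂ back
        x₀γ : mem H (diff x₀ γ) ≡ true
        x₀γ = trans (sym (image-R (R-γ (suc zero)) zero (suc zero))) (trans (cong mem′ (diff-𝟘 a)) p)
        γx₁ : mem H (diff γ x₁) ≡ true
        γx₁ = trans (sym (image-R (R-γ zero) zero (suc zero))) (trans (cong mem′ (diff-⊕ a b)) q)

      imageᴴ : Subgroup {k}
      imageᴴ = record { mem = mem′ ; has𝟘 = image-𝟘 ; closed⊕ = image-⊕ ; closed⊖ = image-⊖ }

      H≐image : H ≐ᴴ imageᴴ
      -- Played from a constant tuple, a move maps `H` bijectively onto the translate of its image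
      -- by `y₀`.
      H≐image = equal-order⇒≐ H imageᴴ (↔-sym (translation y₀) ↔-∘ π) λ g → trans (image-R (proj₂ mv g (suc zero)) zero (suc zero)) (cong (mem H) (diff-𝟘 g))
        where
        z : Tup {k} (suc (suc m′))
        z _ = 𝟘
        y₀ : Fin N
        y₀ = proj₁ (total z) zero
        mv = Game.move (R-game W) (proj₂ (total z))
        π : Fin N ↔ Fin N
        π = proj₁ mv

    R-group : ∀ {x y} → R x y → ∀ i j → (x i ∼[ H ] x j) ⇔ (y i ∼[ H ] y j)
    R-group {x} {y} p i j = mk⇔ (λ (mk∼ h) → mk∼ (trans eq h)) (λ (mk∼ h) → mk∼ (trans (sym eq) h))
      where
      eq : mem H (diff (y i) (y j)) ≡ mem H (diff (x i) (x j))
      eq = trans (H≐image (diff (y i) (y j))) (image-R p i j)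

  -- Lifting the self-equivalence

  WLeq-≤ : ∀ X Y {m} → X ≤ˢ Y → ∀ t {x y : Tup {k} m} → WLeq Y t x y → WLeq X t x y
  WLeq-≤ X Y X≤Y zero h i j = X≤Y _ _ _ _ (h i j)
  WLeq-≤ X Y X≤Y (suc t) (h , π , step) = WLeq-≤ X Y X≤Y t h , π , λ α i → WLeq-≤ X Y X≤Y t (step α i)

  -- The colours of `Xs` are numbered independently of those of `fine-scheme`; the last two
  -- hypotheses say that both define the same partition.
  module Lift (X : Scheme {k}) (U₁ U₀ : Subgroup {k}) (U₁-X : IsXGroup X U₁) (U₀-X : IsXGroup X U₀) (U₀⊆U₁ : U₀ ⊆ᴴ U₁)
    (swap : ∀ a b → a ∼[ U₁ ] b → Swap X U₀ a b) (Xs : Scheme {k})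
    (colour→fine : ∀ {α β γ δ} → c Xs α β ≡ c Xs γ δ → Extension.Fine X U₁ U₀ U₁-X U₀-X U₀⊆U₁ swap α β γ δ)
    (fine→colour : ∀ {α β γ δ} → Extension.Fine X U₁ U₀ U₁-X U₀-X U₀⊆U₁ swap α β γ δ → c Xs α β ≡ c Xs γ δ) where

    open Lifting X U₁ U₀ U₀⊆U₁ swap
    open Extension X U₁ U₀ U₁-X U₀-X U₀⊆U₁ swap using (Fine; colours-groups)

    X≤Xs : X ≤ˢ Xs
    X≤Xs _ _ _ _ e = proj₁ (colour→fine e)

    module _ {m′ : ℕ} where

      private
        T : Set
        T = Tup {k} (suc (suc m′))

      ≈Xs→≈X : ∀ {x y : T} → x ≈[ Xs ] y → x ≈[ X ] y
      ≈Xs→≈X h t = WLeq-≤ X Xs X≤Xs t (h t)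

      ≈Xs→compatible : ∀ {x y : T} → x ≈[ Xs ] y → Compatible U₁ U₀ x y
      ≈Xs→compatible h i j = proj₂ (colour→fine (h 0 i j))

      -- The hypotheses reproduce themselves after each move and so survive every round.
      compatible→≈Xs : ∀ {x y : T} → x ≈[ X ] y → Compatible U₁ U₀ x y → x ≈[ Xs ] y
      compatible→≈Xs h f zero i j = fine→colour (h 0 i j , f i j)
      compatible→≈Xs h f (suc t) = compatible→≈Xs h f t ,
        (let π , step = compatible-move (≈-game X _) (λ U U≡ e → colours-groups (e 0) U U≡) h f in
         π , λ α i → compatible→≈Xs (proj₁ (step α i)) (proj₂ (step α i)) t)

      module _ {φ : AlgAut X} (W : WLSelfEquiv X m′ φ) where

        open WLSelfEquiv W

        R* : T → T → Set
        R* x y = R x y × Compatible U₁ U₀ x y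

        R-groups : ∀ U → U ≡ U₀ ⊎ U ≡ U₁ → ∀ {x y} → R x y → ∀ i j → (x i ∼[ U ] x j) ⇔ (y i ∼[ U ] y j)
        R-groups U (inj₁ refl) = R-group W U₀ U₀-X
        R-groups U (inj₂ refl) = R-group W U₁ U₁-X

        abstract
          R*-move : ∀ {x y} → R* x y → Σ (Fin N ↔ Fin N) λ π → ∀ α i → R* (upd x i α) (upd y i (Inverse.to π α))
          R*-move (p , f) = compatible-move (R-game W) R-groups p f

        compatible-trans : ∀ {x y z : T} → (∀ i j → x i ∼[ U₁ ] x j → y i ∼[ U₁ ] y j) →
          Compatible U₁ U₀ x y → Compatible U₁ U₀ y z → Compatible U₁ U₀ x z
        compatible-trans g f h i j n = ∥-trans U₀ (f i j n) (h i j (g i j n))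

        ≈-near : ∀ {x y : T} → x ≈[ Xs ] y → ∀ i j → x i ∼[ U₁ ] x j → y i ∼[ U₁ ] y j
        ≈-near e i j = group-∼ X U₁ U₁-X (X≤Xs _ _ _ _ (e 0 i j))

        R*-resp : ∀ x x′ y y′ → x ≈[ Xs ] x′ → y ≈[ Xs ] y′ → R* x y → R* x′ y′
        R*-resp x x′ y y′ e e′ (p , f) = resp x x′ y y′ (≈Xs→≈X e) (≈Xs→≈X e′) p ,
          compatible-trans (≈-near (≈-sym Xs e)) (≈Xs→compatible (≈-sym Xs e))
            (compatible-trans (λ i j → Equivalence.to (R-groups U₁ (inj₂ refl) p i j)) f (≈Xs→compatible e′))

        R*-resp-≗ : ∀ {x x′ y y′} → x ≗ x′ → y ≗ y′ → R* x y → R* x′ y′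
        R*-resp-≗ e f = R*-resp _ _ _ _ (≗→≈ Xs e) (≗→≈ Xs f)

        R*-seed : ∀ {x y} → R x y → (∀ i j → x i ≡ x j) → (∀ i j → y i ≡ y j) → R* x y
        R*-seed {x} {y} p e f = p , λ i j _ → subst₂ (λ β δ → Par U₀ (x i) β (y i) δ) (e i j) (f i j) (∥-diagonal U₀)

        private
          agree-upd : ∀ (x z : T) j (js : List (Fin (suc (suc m′)))) → (∀ i → i ∈ js → z i ≡ x i) →
            ∀ i → i ∈ j ∷ js → upd z j (x j) i ≡ x i
          agree-upd x z j js h i i∈ with j ≟ i
          ... | yes refl = refl
          agree-upd x z j js h i (here i≡j) | no j≢i = ⊥-elim (j≢i (sym i≡j))
          agree-upd x z j js h i (there i∈) | no _ = h i i∈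

        abstract
          -- Starting from constant tuples, the entries are put in place one after the other.
          R*-total : ∀ x → ∃[ y ] R* x y
          R*-total x = let z , y , p , e = fill (allFin _) in y , R*-resp-≗ (λ i → e i (∈-allFin i)) (λ _ → refl) p
            where
            fill : ∀ js → ∃[ z ] ∃[ y ] (R* z y × (∀ i → i ∈ js → z i ≡ x i))
            fill [] = let y , p = total (λ _ → 𝟘) in (λ _ → 𝟘) , y , R*-seed p (λ _ _ → refl) (R-const W p (λ _ _ → refl)) , λ _ ()
            fill (j ∷ js) = let z , y , p , e = fill js ; π , step = R*-move p in
              upd z j (x j) , upd y j (Inverse.to π (x j)) , step (x j) j , agree-upd x z j js e

          R*-onto : ∀ y → ∃[ x ] R* x y
          R*-onto y = let x , z , p , e = fill (allFin _) in x , R*-resp-≗ (λ _ → refl) (λ i → e i (∈-allFin i)) p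
            where
            fill : ∀ js → ∃[ x ] ∃[ z ] (R* x z × (∀ i → i ∈ js → z i ≡ y i))
            fill [] = let x , p = onto (λ _ → 𝟘) in x , (λ _ → 𝟘) , R*-seed p (R-const⁻¹ W p (λ _ _ → refl)) (λ _ _ → refl) , λ _ ()
            fill (j ∷ js) = let x , z , p , e = fill js ; α , step = move-back {Q = R*} (R*-move p) (y j) in
              upd x j α , upd z j (y j) , step j , agree-upd y z j js e

        -- The fine class of an image pair depends only on that of the original pair, whichever
        -- tuples contain them. This makes `ψ` well defined, and the converse makes it injective.
        R*-fine : ∀ {x y x′ y′} → R* x y → R* x′ y′ → ∀ {i j i′ j′} → Fine (x i) (x j) (x′ i′) (x′ j′) → Fine (y i) (y j) (y′ i′) (y′ j′)
        R*-fine {x} {y} {x′} {y′} (p , f) (p′ , f′) {i} {j} {i′} {j′} (e , g) =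
          trans (coord-eq W p i j) (trans (cong (app φ) e) (sym (coord-eq W p′ i′ j′))) ,
          λ n → let n′ = Equivalence.from (R-groups U₁ (inj₂ refl) p i j) n in
            ∥-trans U₀ (∥-sym U₀ (f i j n′)) (∥-trans U₀ (g n′) (f′ i′ j′ (group-∼ X U₁ U₁-X e n′)))

        R*-fine⁻¹ : ∀ {x y x′ y′} → R* x y → R* x′ y′ → ∀ {i j i′ j′} → Fine (y i) (y j) (y′ i′) (y′ j′) → Fine (x i) (x j) (x′ i′) (x′ j′)
        R*-fine⁻¹ {x} {y} {x′} {y′} (p , f) (p′ , f′) {i} {j} {i′} {j′} (e , g) = e′ ,
          λ n → let n′ = group-∼ X U₁ U₁-X e′ n in
            ∥-trans U₀ (f i j n) (∥-trans U₀ (g (Equivalence.to (R-groups U₁ (inj₂ refl) p i j) n)) (∥-sym U₀ (f′ i′ j′ n′)))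
          where
          e′ : c X (x i) (x j) ≡ c X (x′ i′) (x′ j′)
          e′ = trans (sym (Inverse.strictlyInverseʳ (perm φ) _)) (trans (cong (Inverse.from (perm φ))
            (trans (sym (coord-eq W p i j)) (trans e (coord-eq W p′ i′ j′)))) (Inverse.strictlyInverseʳ (perm φ) _))

        private
          rep : Fin (r Xs) → T
          rep s = pair (proj₁ (nonempty Xs s)) (proj₁ (proj₂ (nonempty Xs s)))

          rep-colour : ∀ s → c Xs (rep s zero) (rep s (suc zero)) ≡ s
          rep-colour s = proj₂ (proj₂ (nonempty Xs s))

          img : Fin (r Xs) → T
          img s = proj₁ (R*-total (rep s))

          img-R* : ∀ s → R* (rep s) (img s)
          img-R* s = proj₂ (R*-total (rep s))

          ψ : Fin (r Xs) → Fin (r Xs)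
          ψ s = c Xs (img s zero) (img s (suc zero))

          ψ-spec : ∀ {x y} → R* x y → ∀ i j → c Xs (y i) (y j) ≡ ψ (c Xs (x i) (x j))
          ψ-spec p i j = fine→colour (R*-fine p (img-R* _) {i} {j} {zero} {suc zero} (colour→fine (sym (rep-colour _))))

          ψ-injective : ∀ {s s′} → ψ s ≡ ψ s′ → s ≡ s′
          ψ-injective {s} {s′} e = trans (sym (rep-colour s)) (trans
            (fine→colour (R*-fine⁻¹ (img-R* s) (img-R* s′) {zero} {suc zero} {zero} {suc zero} (colour→fine e))) (rep-colour s′))

          Ψ : Fin (r Xs) ↔ Fin (r Xs)
          Ψ = proj₁ (injective→bijection ψ ψ-injective)

          -- A move matches the intermediate points of `x` with those of `y` and acts on their
          -- colours by the injective map `ψ`, so the counts agree. Coherence passes from `y` to the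
          -- given pair.
          ψ-preserve : ∀ α β α′ β′ → c Xs α′ β′ ≡ ψ (c Xs α β) → ∀ s₁ s₂ →
            isect (c Xs) α′ β′ (ψ s₁) (ψ s₂) ≡ isect (c Xs) α β s₁ s₂
          ψ-preserve α β α′ β′ e s₁ s₂ = begin
            isect (c Xs) α′ β′ (ψ s₁) (ψ s₂)   ≡⟨ coherent Xs α′ β′ y₀ y₁ (trans e (sym (ψ-spec xy zero (suc zero)))) _ _ ⟩
            isect (c Xs) y₀ y₁ (ψ s₁) (ψ s₂)   ≡⟨ isect-# Xs y₀ y₁ _ _ ⟩
            # ψat                              ≡⟨ #-bijection at ψat π
              (λ ξ (p , q) → trans (e₀ ξ) (cong ψ p) , trans (e₁ ξ) (cong ψ q))
              (λ ξ (p , q) → ψ-injective (trans (sym (e₀ ξ)) p) , ψ-injective (trans (sym (e₁ ξ)) q)) ⟨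
            # at                               ≡⟨ isect-# Xs α β s₁ s₂ ⟨
            isect (c Xs) α β s₁ s₂ ∎
            where
            open ≡-Reasoning
            x y : T
            x = pair α β
            y = proj₁ (R*-total x)
            xy : R* x y
            xy = proj₂ (R*-total x)
            y₀ y₁ : Fin N
            y₀ = y zero
            y₁ = y (suc zero)
            π : Fin N ↔ Fin N
            π = proj₁ (R*-move xy)
            step : ∀ ξ i → R* (upd x i ξ) (upd y i (Inverse.to π ξ))
            step = proj₂ (R*-move xy)
            at : ∀ ξ → Dec (c Xs α ξ ≡ s₁ × c Xs ξ β ≡ s₂)
            at ξ = (c Xs α ξ ≟ s₁) ×-dec (c Xs ξ β ≟ s₂)
            ψat : ∀ ξ → Dec (c Xs y₀ ξ ≡ ψ s₁ × c Xs ξ y₁ ≡ ψ s₂)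
            ψat ξ = (c Xs y₀ ξ ≟ ψ s₁) ×-dec (c Xs ξ y₁ ≟ ψ s₂)
            e₀ : ∀ ξ → c Xs y₀ (Inverse.to π ξ) ≡ ψ (c Xs α ξ)
            e₀ ξ = ψ-spec (step ξ (suc zero)) zero (suc zero)
            e₁ : ∀ ξ → c Xs (Inverse.to π ξ) y₁ ≡ ψ (c Xs ξ β)
            e₁ ξ = ψ-spec (step ξ zero) zero (suc zero)

        φ* : AlgAut Xs
        φ* = record { perm = Ψ ; preserve = ψ-preserve }

        φ*-extends : Extends X Xs φ φ*
        φ*-extends α β γ δ e = let y , p = R*-total (pair α β) in
          trans (X≤Xs _ _ _ _ (trans e (sym (ψ-spec p zero (suc zero))))) (coord-eq W (proj₁ p) zero (suc zero))

        R*-func : ∀ x y y′ → R* x y → R* x y′ → y ≈[ Xs ] y′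
        R*-func x y y′ p q = compatible→≈Xs (func x y y′ (proj₁ p) (proj₁ q))
          (λ i j → proj₂ (R*-fine p q {i} {j} {i} {j} (refl , λ _ → ∥-refl U₀)))

        R*-inj : ∀ x x′ y → R* x y → R* x′ y → x ≈[ Xs ] x′
        R*-inj x x′ y p q = compatible→≈Xs (inj x x′ y (proj₁ p) (proj₁ q))
          (λ i j → proj₂ (R*-fine⁻¹ p q {i} {j} {i} {j} (refl , λ _ → ∥-refl U₀)))

        φ*-equiv : WLSelfEquiv Xs m′ φ*
        φ*-equiv = record
          { R = R*
          ; resp = R*-resp
          ; total = R*-total
          ; onto = R*-onto
          ; func = R*-func
          ; inj = R*-inj
          ; coord = λ σ x y (p , f) → coord σ x y p , λ i j → f (σ i) (σ j)
          -- The move already relates the updated tuples by `R*`; that `R*` is functional and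
          -- injective on classes translates membership both ways.
          ; numbers = λ x y p z w zw → let π , step = R*-move p in π , λ α → mk⇔
              (λ e i → R*-func (z i) _ _ (R*-resp _ _ _ _ (e i) (λ t → WLeq-refl Xs t _) (step α i)) (zw i))
              (λ e i → R*-inj _ _ (w i) (R*-resp _ _ _ _ (λ t → WLeq-refl Xs t _) (e i) (step α i)) (zw i))
          ; proj₂-agrees = λ x y p → ψ-spec p zero (suc zero)
          }

theorem5p4 : ∀ {k : ℕ} (X : Scheme {k}) (S : Section X) (Xs : Scheme {k}) →
    SingularClassOf X S → IsExtension X S Xs →
    (φ : AlgAut X) (m' : ℕ) → WLSelfEquiv X m' φ →
    Σ (AlgAut Xs) (λ φs → Extends X Xs φ φs × WLSelfEquiv Xs m' φs)
theorem5p4 {k} X S Xs ((T , S≈T , T-trivial) , _ , T₁ , T₂ , S≈T₁ , S≈T₂ , (meet , prod) , (cond₀ , cond₁) , tensor)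
  (X≤Xs , Xs-regular , Xs-least) φ m' W = φ* W , φ*-extends W , φ*-equiv W
  where
  -- Triviality is known for some `T` in the class; as homogeneity it travels through `S` to `T₁`.
  hom : Homogeneous X (U T₁) (L T₁)
  hom = Equivalence.to (homogeneous-ProjEq X S≈T₁)
    (Equivalence.from (homogeneous-ProjEq X S≈T) (Homogeneous-of-Trivial X T T-trivial))
  open Swaps X (U T₂) (U T₁) (L T₂) (L T₁) (U-X T₂) (L-X T₂) meet prod cond₀ cond₁ tensor hom
  open Extension X (U T₂) (L T₂) (U-X T₂) (L-X T₂) (L⊆U T₂) swap
  colour→fine : ∀ {α β γ δ} → c Xs α β ≡ c Xs γ δ → Fine α β γ δ
  colour→fine {α} {β} {γ} {δ} e = X≤Xs α β γ δ e , Equivalence.to (regular-ProjEq X Xs X≤Xs S≈T₂)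
    (RegularOn→Regular Xs (group-≤ X Xs (U S) X≤Xs (U-X S)) Xs-regular) e
  -- Regularity of the split scheme is carried from `T₂` back to `S`, where minimality of `Xs`
  -- applies.
  Xs≤fine : Xs ≤ˢ fine-scheme
  Xs≤fine = Xs-least fine-scheme X≤fine (Regular→RegularOn fine-scheme (group-≤ X fine-scheme (U S) X≤fine (U-X S))
    (Equivalence.from (regular-ProjEq X fine-scheme X≤fine S≈T₂) fine-regular))
  open Lift X (U T₂) (L T₂) (U-X T₂) (L-X T₂) (L⊆U T₂) swap Xs colour→fine (λ f → Xs≤fine _ _ _ _ (fine→colour f))
    using (φ*; φ*-extends; φ*-equiv)
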